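{- Let $\mathcal{E}$ be a natural $t$-efficient error metric. There is a deterministic algorithm $\mathcal{A}_{\mathrm{InstanceOpt},\mathcal{E}}$ with the following guarantee. Given as input a $q$-query RDT $R$ over $n$ variables with description length $N$ and an error parameter $\varepsilon\in(0,1)$, let $$q^\star_{R,\mathcal{E}}:=\min\{\,q' : \text{there is a } q'\text{ -query DDT } D \text{ such that } \mathcal{E}(R,D)\le\varepsilon\,\}.$$ Then $\mathcal{A}_{\mathrm{InstanceOpt},\mathcal{E}}$ runs in time $\mathrm{poly}(N,t,n^{q^\star_{R,\mathcal{E}}})$ and returns a $q^\star_{R,\mathcal{E}}$-query DDT $D$ satisfying $\mathcal{E}(R,D)\le\varepsilon$.
   Context: An $n$-variable randomized decision tree (RDT) is a binary tree with two types of internal nodes: decision nodes, which branch on the value of one of the boolean variables $x_1,\dots,x_n$, and stochastic nodes, which branch on the outcome of an independent $\mathrm{Bernoulli}(\frac12)$ random bit. Leaves are labelled by values in $[0,1]$. Its query complexity is the maximum number of decision nodes on any root-to-leaf path, and its randomness complexity is the maximum number $m$ of stochastic nodes on any root-to-leaf path; it is $q$-query if its query complexity is at most $q$. The RDT computes a function $R:\{0,1\}^n\times\{0,1\}^m\to[0,1]$, where $R(x,r)$ is the label of the leaf reached on input $x$ when the stochastic nodes encountered branch according to the bits of $r$. Its mean function is $\mu_R(x)=\mathbb{E}_{r\sim\{0,1\}^m}[R(x,r)]$ ($r$ uniform). A deterministic decision tree (DDT) is an RDT with no stochastic nodes, computing $D:\{0,1\}^n\to[0,1]$. The description length is the length of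 the description of the tree. An error metric is a map $\mathcal{E}:\{\text{RDTs}\}\times\{\text{DDTs}\}\to[0,1]$. It is natural if there is some $d:[0,1]\times[0,1]\to[0,1]$ such that $\mathcal{E}(R,D)=\mathbb{E}_{x}[d(\mu_R(x),D(x))]$ for uniform $x\sim\{0,1\}^n$. For $t=t(q)$ a function of $q$, $\mathcal{E}$ is $t$-efficient if for all $q$-query RDTs $R$ and DDTs $D$ of description lengths $N_R$ and $N_D$ respectively: (1) there is a deterministic $\mathrm{poly}(t,N_R,N_D)$-time algorithm that computes $\mathcal{E}(R,D)$; (2) there is a deterministic $\mathrm{poly}(t,N_R)$-time algorithm that computes the constant $c\in[0,1]$ minimizing $\mathcal{E}(R,c)$. -}

module Defs where

open import Algebra.Bundles using (CommutativeRing)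
open import Algebra.Structures using (IsCommutativeRing)
import Algebra.Properties.Ring as RingProperties
open import Data.Bool.Base using (Bool; true; false; if_then_else_)
open import Data.Empty using (⊥-elim)
open import Data.Fin.Base using (Fin; toℕ)
open import Data.List.Base using (List; []; _∷_; _++_; map; length)
open import Data.List.Properties using (length-++; length-map)
open import Data.Nat.Base as ℕ using (ℕ; zero; suc; _⊔_)
open import Data.Nat.Binary.Base as ℕᵇ using (ℕᵇ; 2[1+_]; 1+[2_])
import Data.Nat.Properties as ℕₚ
open import Data.Product.Base using (Σ; ∃-syntax; _×_; _,_)
open import Data.Sum.Base using (inj₁; inj₂)
open import Data.Vec.Base as Vec using (Vec; []; _∷_; lookup)
open import Function.Base using (_∘_)
open import Relation.Binary.PropositionalEquality
open import Relation.Binary.Structures using (IsDecTotalOrder)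
open import Relation.Nullary.Decidable.Core using (does; recompute)

data Poly (m : ℕ) : Set where
  con     : ℕ → Poly m
  var     : Fin m → Poly m
  _⊕_ _⊗_ : Poly m → Poly m → Poly m

⟦_⟧ : ∀ {m} → Poly m → Vec ℕ m → ℕ
⟦ con c ⟧ as = c
⟦ var i ⟧ as = lookup as i
⟦ p ⊕ q ⟧ as = ⟦ p ⟧ as ℕ.+ ⟦ q ⟧ as
⟦ p ⊗ q ⟧ as = ⟦ p ⟧ as ℕ.* ⟦ q ⟧ as

IsLeast : (ℕ → Set) → ℕ → Set
IsLeast P k = P k × (∀ j → P j → k ℕ.≤ j)

-- The numbers that label leaves and measure errors.  Any ordered field with
-- decidable order is admitted, so that both readings of "a number in [0,1]"
-- given to an algorithm are covered: `size` constantly 0 is exact arithmetic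
-- at unit cost, as on a real RAM, while the rationals with `size` the bit
-- length are charged for every bit.  The value of 0# ⁻¹ is unconstrained.
record Scalars : Set₁ where
  infixl 6 _+_
  infixl 7 _*_
  infix  8 -_
  infix  9 _⁻¹
  infix  4 _≤_ _<_
  field
    Carrier           : Set
    _+_ _*_           : Carrier → Carrier → Carrier
    -_ _⁻¹            : Carrier → Carrier
    0# 1#             : Carrier
    isCommutativeRing : IsCommutativeRing _≡_ _+_ _*_ -_ 0# 1#
    0≢1               : 0# ≢ 1#
    ⁻¹-inverseʳ       : ∀ x → x ≢ 0# → x * x ⁻¹ ≡ 1#
    _≤_               : Carrier → Carrier → Set
    isDecTotalOrder   : IsDecTotalOrder _≡_ _≤_
    +-monoˡ-≤         : ∀ z {x y} → x ≤ y → x + z ≤ y + z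
    *-nonNeg          : ∀ {x y} → 0# ≤ x → 0# ≤ y → 0# ≤ x * y
    size              : Carrier → ℕ

  _<_ : Carrier → Carrier → Set
  x < y = x ≤ y × x ≢ y

  open IsDecTotalOrder isDecTotalOrder public
    using (_≤?_; total; antisym)
    renaming (refl to ≤-refl; trans to ≤-trans; reflexive to ≤-reflexive)

  commutativeRing : CommutativeRing _ _
  commutativeRing = record { isCommutativeRing = isCommutativeRing }

  open CommutativeRing commutativeRing public using
    ( +-assoc; +-comm; +-identityˡ; +-identityʳ; -‿inverseˡ; -‿inverseʳ
    ; *-identityʳ; distribʳ; ring )

  open RingProperties ring public
    using (-‿distribˡ-*; -‿distribʳ-*; -‿involutive)

  +-mono-≤ : ∀ {w x y z} → w ≤ x → y ≤ z → w + y ≤ x + z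
  +-mono-≤ {w} {x} {y} {z} w≤x y≤z =
    ≤-trans (+-monoˡ-≤ y w≤x)
      (subst₂ _≤_ (+-comm y x) (+-comm z x) (+-monoˡ-≤ x y≤z))

  +-nonNeg : ∀ {x y} → 0# ≤ x → 0# ≤ y → 0# ≤ x + y
  +-nonNeg {x} {y} 0≤x 0≤y =
    subst (λ z → z ≤ x + y) (+-identityˡ 0#) (+-mono-≤ 0≤x 0≤y)

  neg-nonNeg : ∀ {x} → x ≤ 0# → 0# ≤ - x
  neg-nonNeg {x} x≤0 =
    subst₂ _≤_ (-‿inverseʳ x) (+-identityˡ (- x)) (+-monoˡ-≤ (- x) x≤0)

  0≤1 : 0# ≤ 1#
  0≤1 with total 0# 1#
  ... | inj₁ h = h
  ... | inj₂ h = subst (0# ≤_) -1*-1≡1 (*-nonNeg (neg-nonNeg h) (neg-nonNeg h))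
    where
    -1*-1≡1 : - 1# * - 1# ≡ 1#
    -1*-1≡1 = trans (sym (-‿distribʳ-* (- 1#) 1#))
                (trans (cong -_ (*-identityʳ (- 1#))) (-‿involutive 1#))

  ⁻¹-nonNeg : ∀ {x} → 0# ≤ x → x ≢ 0# → 0# ≤ x ⁻¹
  ⁻¹-nonNeg {x} 0≤x x≢0 with total 0# (x ⁻¹)
  ... | inj₁ h = h
  ... | inj₂ h = ⊥-elim (0≢1 (antisym 0≤1 1≤0))
    where
    0≤-1 : 0# ≤ - 1#
    0≤-1 = subst (0# ≤_)
      (trans (sym (-‿distribʳ-* x (x ⁻¹))) (cong -_ (⁻¹-inverseʳ x x≢0)))
      (*-nonNeg 0≤x (neg-nonNeg h))
    1≤0 : 1# ≤ 0#
    1≤0 = subst₂ _≤_ (+-identityˡ 1#) (trans (+-comm (- 1#) 1#) (-‿inverseʳ 1#))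
            (+-monoˡ-≤ 1# 0≤-1)

  *-monoʳ-≤ : ∀ {x y z} → 0# ≤ z → x ≤ y → x * z ≤ y * z
  *-monoʳ-≤ {x} {y} {z} 0≤z x≤y =
    subst₂ _≤_ (+-identityˡ (x * z)) y*z-x*z+x*z≡y*z (+-monoˡ-≤ (x * z) 0≤y*z-x*z)
    where
    0≤y-x : 0# ≤ y + - x
    0≤y-x = subst (_≤ y + - x) (-‿inverseʳ x) (+-monoˡ-≤ (- x) x≤y)
    0≤y*z-x*z : 0# ≤ y * z + - (x * z)
    0≤y*z-x*z = subst (0# ≤_)
      (trans (distribʳ z y (- x)) (cong (y * z +_) (sym (-‿distribˡ-* x z))))
      (*-nonNeg 0≤y-x 0≤z)
    y*z-x*z+x*z≡y*z : y * z + - (x * z) + x * z ≡ y * z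
    y*z-x*z+x*z≡y*z = trans (+-assoc _ _ _)
      (trans (cong (y * z +_) (-‿inverseˡ (x * z))) (+-identityʳ (y * z)))

module Theory (𝕂 : Scalars) where

  open Scalars 𝕂

  record [0,1] : Set where
    constructor mk
    field
      value    : Carrier
      .0≤value : 0# ≤ value
      .value≤1 : value ≤ 1#
  open [0,1] public

  cube : ∀ m → List (Vec Bool m)
  cube zero    = [] ∷ []
  cube (suc m) = map (false ∷_) (cube m) ++ map (true ∷_) (cube m)

  ∑ : ∀ {A : Set} → (A → Carrier) → List A → Carrier
  ∑ f []       = 0#
  ∑ f (a ∷ as) = f a + ∑ f as

  fromℕ : ℕ → Carrier
  fromℕ zero    = 0#
  fromℕ (suc n) = 1# + fromℕ n

  mean : ∀ m → (Vec Bool m → Carrier) → Carrier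
  mean m f = ∑ f (cube m) * fromℕ (2 ℕ.^ m) ⁻¹

  private
    length-cube : ∀ m → length (cube m) ≡ 2 ℕ.^ m
    length-cube zero    = refl
    length-cube (suc m) = begin
      length (map (false ∷_) (cube m) ++ map (true ∷_) (cube m))
        ≡⟨ length-++ (map (false ∷_) (cube m)) ⟩
      length (map (false ∷_) (cube m)) ℕ.+ length (map (true ∷_) (cube m))
        ≡⟨ cong₂ ℕ._+_ (length-map _ (cube m)) (length-map _ (cube m)) ⟩
      length (cube m) ℕ.+ length (cube m)
        ≡⟨ cong₂ ℕ._+_ (length-cube m) (trans (length-cube m) (sym (ℕₚ.+-identityʳ _))) ⟩
      2 ℕ.^ suc m ∎
      where open ≡-Reasoning

    fromℕ-nonNeg : ∀ n → 0# ≤ fromℕ n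
    fromℕ-nonNeg zero    = ≤-refl
    fromℕ-nonNeg (suc n) = +-nonNeg 0≤1 (fromℕ-nonNeg n)

    fromℕ-≢0 : ∀ n → .{{ℕ.NonZero n}} → fromℕ n ≢ 0#
    fromℕ-≢0 (suc n) 1+n≡0 = 0≢1 (antisym 0≤1 (subst₂ _≤_ (+-identityʳ 1#) 1+n≡0
      (+-mono-≤ (≤-refl {1#}) (fromℕ-nonNeg n))))

    module _ {A : Set} (f : A → [0,1]) where
      ∑-nonNeg : ∀ as → 0# ≤ ∑ (value ∘ f) as
      ∑-nonNeg []       = ≤-refl
      ∑-nonNeg (a ∷ as) with f a
      ... | mk v 0≤v _ = +-nonNeg (recompute (0# ≤? v) 0≤v) (∑-nonNeg as)

      ∑-≤-length : ∀ as → ∑ (value ∘ f) as ≤ fromℕ (length as)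
      ∑-≤-length []       = ≤-refl
      ∑-≤-length (a ∷ as) with f a
      ... | mk v _ v≤1 = +-mono-≤ (recompute (v ≤? 1#) v≤1) (∑-≤-length as)

    module _ (m : ℕ) where
      instance
        2^m≢0 : ℕ.NonZero (2 ℕ.^ m)
        2^m≢0 = ℕₚ.m^n≢0 2 m

      1/2^m-nonNeg : 0# ≤ fromℕ (2 ℕ.^ m) ⁻¹
      1/2^m-nonNeg = ⁻¹-nonNeg (fromℕ-nonNeg (2 ℕ.^ m)) (fromℕ-≢0 (2 ℕ.^ m))

      mean-nonNeg : ∀ (f : Vec Bool m → [0,1]) → 0# ≤ mean m (value ∘ f)
      mean-nonNeg f = *-nonNeg (∑-nonNeg f (cube m)) 1/2^m-nonNeg

      mean-≤1 : ∀ (f : Vec Bool m → [0,1]) → mean m (value ∘ f) ≤ 1#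
      mean-≤1 f = ≤-trans
        (*-monoʳ-≤ 1/2^m-nonNeg
          (subst (λ k → ∑ (value ∘ f) (cube m) ≤ fromℕ k) (length-cube m) (∑-≤-length f (cube m))))
        (≤-reflexive (⁻¹-inverseʳ _ (fromℕ-≢0 (2 ℕ.^ m))))

  𝔼 : ∀ {m} → (Vec Bool m → [0,1]) → [0,1]
  𝔼 {m} f = mk (mean m (value ∘ f)) (mean-nonNeg m f) (mean-≤1 m f)

  data RDT (n : ℕ) : Set where
    leaf   : [0,1] → RDT n
    query  : Fin n → RDT n → RDT n → RDT n
    random : RDT n → RDT n → RDT n

  queries : ∀ {n} → RDT n → ℕ
  queries (leaf _)      = 0
  queries (query _ l r) = suc (queries l ⊔ queries r)
  queries (random l r)  = queries l ⊔ queries r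

  randomness : ∀ {n} → RDT n → ℕ
  randomness (leaf _)      = 0
  randomness (query _ l r) = randomness l ⊔ randomness r
  randomness (random l r)  = suc (randomness l ⊔ randomness r)

  -- The j-th stochastic node met along a path branches on the j-th random bit.
  run : ∀ {n m} (T : RDT n) → .(randomness T ℕ.≤ m) → Vec Bool n → Vec Bool m → [0,1]
  run (leaf v)      _ x bs       = v
  run (query i l r) h x bs       =
    if lookup x i then run r (ℕₚ.m⊔n≤o⇒n≤o (randomness l) _ h) x bs
                  else run l (ℕₚ.m⊔n≤o⇒m≤o _ (randomness r) h) x bs
  run (random l r)  h x (b ∷ bs) =
    if b then run r (ℕₚ.m⊔n≤o⇒n≤o (randomness l) _ (ℕ.s≤s⁻¹ h)) x bs
         else run l (ℕₚ.m⊔n≤o⇒m≤o _ (randomness r) (ℕ.s≤s⁻¹ h)) x bs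

  μ : ∀ {n} → RDT n → Vec Bool n → [0,1]
  μ R x = 𝔼 {randomness R} λ r → run R ℕₚ.≤-refl x r

  record DDT (n : ℕ) : Set where
    constructor mk
    field
      tree           : RDT n
      .deterministic : randomness tree ≡ 0
  open DDT public

  evaluate : ∀ {n} → DDT n → Vec Bool n → [0,1]
  evaluate (mk T det) x = run T (ℕₚ.≤-reflexive det) x []

  constant : ∀ {n} → [0,1] → DDT n
  constant c = mk (leaf c) refl

  -- Algorithms are first-order recursive programs on S-expressions over
  -- scalars.
  data Val : Set where
    nil    : Val
    scalar : Carrier → Val
    _∙_    : Val → Val → Val
  infixr 5 _∙_

  ∣_∣ : Val → ℕ
  ∣ nil ∣      = 1
  ∣ scalar k ∣ = suc (size k)
  ∣ u ∙ v ∣    = suc (∣ u ∣ ℕ.+ ∣ v ∣)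

  data Op : Set where
    id fst snd pair? scalar? add mul neg inv leq : Op

  ⌜_⌝ᵇ : Bool → Val
  ⌜ false ⌝ᵇ = nil
  ⌜ true ⌝ᵇ  = nil ∙ nil

  -- Arguments of the wrong shape give nil.
  apply : Op → Val → Val
  apply id      v                       = v
  apply fst     (u ∙ v)                 = u
  apply snd     (u ∙ v)                 = v
  apply pair?   (u ∙ v)                 = ⌜ true ⌝ᵇ
  apply scalar? (scalar a)              = ⌜ true ⌝ᵇ
  apply add     (scalar a ∙ scalar b)   = scalar (a + b)
  apply mul     (scalar a ∙ scalar b)   = scalar (a * b)
  apply neg     (scalar a)              = scalar (- a)
  apply inv     (scalar a)              = scalar (a ⁻¹)
  apply leq     (scalar a ∙ scalar b)   = ⌜ does (a ≤? b) ⌝ᵇ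
  apply _       _                       = nil

  -- Prog k: programs in the scope of k recursive definitions.  `rec p` makes
  -- `self` in p refer to p; `↑` discards the innermost definition.
  data Prog : ℕ → Set where
    const         : ∀ {k} → Val → Prog k
    prim          : ∀ {k} → Op → Prog k
    _⨾_ ⟨_,_⟩     : ∀ {k} → Prog k → Prog k → Prog k
    ifte          : ∀ {k} → Prog k → Prog k → Prog k → Prog k
    rec           : ∀ {k} → Prog (suc k) → Prog k
    self          : ∀ {k} → Prog (suc k)
    ↑             : ∀ {k} → Prog k → Prog (suc k)
  infixr 4 _⨾_

  data Env : ℕ → Set where
    []  : Env 0
    _▹_ : ∀ {k} → Env k → Prog (suc k) → Env (suc k)
  infixl 5 _▹_

  -- ρ ⊢ p · v ⇓ w ⟨ c ⟩: on input v, p returns w in time c.  Each step costs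
  -- the size of the value it reads plus that of the value it writes, so no
  -- value is ever shared or copied for free.
  infix 3 _⊢_·_⇓_⟨_⟩
  data _⊢_·_⇓_⟨_⟩ : ∀ {k} → Env k → Prog k → Val → Val → ℕ → Set where
    const : ∀ {k} {ρ : Env k} {v w} →
            ρ ⊢ const w · v ⇓ w ⟨ ∣ v ∣ ℕ.+ ∣ w ∣ ⟩
    prim  : ∀ {k} {ρ : Env k} {o v} →
            ρ ⊢ prim o · v ⇓ apply o v ⟨ ∣ v ∣ ℕ.+ ∣ apply o v ∣ ⟩
    seq   : ∀ {k} {ρ : Env k} {p q u v w a b} →
            ρ ⊢ p · u ⇓ v ⟨ a ⟩ → ρ ⊢ q · v ⇓ w ⟨ b ⟩ →
            ρ ⊢ p ⨾ q · u ⇓ w ⟨ ∣ u ∣ ℕ.+ ∣ w ∣ ℕ.+ (a ℕ.+ b) ⟩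
    fork  : ∀ {k} {ρ : Env k} {p q u v w a b} →
            ρ ⊢ p · u ⇓ v ⟨ a ⟩ → ρ ⊢ q · u ⇓ w ⟨ b ⟩ →
            ρ ⊢ ⟨ p , q ⟩ · u ⇓ v ∙ w ⟨ ∣ u ∣ ℕ.+ ∣ v ∙ w ∣ ℕ.+ (a ℕ.+ b) ⟩
    then  : ∀ {k} {ρ : Env k} {t p q u v w a b} →
            ρ ⊢ t · u ⇓ v ⟨ a ⟩ → v ≢ nil → ρ ⊢ p · u ⇓ w ⟨ b ⟩ →
            ρ ⊢ ifte t p q · u ⇓ w ⟨ ∣ u ∣ ℕ.+ ∣ w ∣ ℕ.+ (a ℕ.+ b) ⟩
    else  : ∀ {k} {ρ : Env k} {t p q u w a b} →
            ρ ⊢ t · u ⇓ nil ⟨ a ⟩ → ρ ⊢ q · u ⇓ w ⟨ b ⟩ →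
            ρ ⊢ ifte t p q · u ⇓ w ⟨ ∣ u ∣ ℕ.+ ∣ w ∣ ℕ.+ (a ℕ.+ b) ⟩
    rec   : ∀ {k} {ρ : Env k} {p u w a} →
            ρ ▹ p ⊢ p · u ⇓ w ⟨ a ⟩ →
            ρ ⊢ rec p · u ⇓ w ⟨ ∣ u ∣ ℕ.+ ∣ w ∣ ℕ.+ a ⟩
    self  : ∀ {k} {ρ : Env k} {p u w a} →
            ρ ▹ p ⊢ p · u ⇓ w ⟨ a ⟩ →
            ρ ▹ p ⊢ self · u ⇓ w ⟨ ∣ u ∣ ℕ.+ ∣ w ∣ ℕ.+ a ⟩
    ↑     : ∀ {k} {ρ : Env k} {p q u w a} →
            ρ ⊢ p · u ⇓ w ⟨ a ⟩ →
            ρ ▹ q ⊢ ↑ p · u ⇓ w ⟨ ∣ u ∣ ℕ.+ ∣ w ∣ ℕ.+ a ⟩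

  ⇓-deterministic : ∀ {k} {ρ : Env k} {p u v w a b} →
                    ρ ⊢ p · u ⇓ v ⟨ a ⟩ → ρ ⊢ p · u ⇓ w ⟨ b ⟩ → (v , a) ≡ (w , b)
  ⇓-deterministic const const = refl
  ⇓-deterministic prim prim = refl
  ⇓-deterministic (seq d e) (seq d′ e′)
    with refl ← ⇓-deterministic d d′ with refl ← ⇓-deterministic e e′ = refl
  ⇓-deterministic (fork d e) (fork d′ e′)
    with refl ← ⇓-deterministic d d′ with refl ← ⇓-deterministic e e′ = refl
  ⇓-deterministic (then d _ e) (then d′ _ e′)
    with refl ← ⇓-deterministic d d′ with refl ← ⇓-deterministic e e′ = refl
  ⇓-deterministic (then d v≢nil _) (else d′ _)
    with refl ← ⇓-deterministic d d′ = ⊥-elim (v≢nil refl)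
  ⇓-deterministic (else d _) (then d′ v≢nil _)
    with refl ← ⇓-deterministic d d′ = ⊥-elim (v≢nil refl)
  ⇓-deterministic (else d e) (else d′ e′)
    with refl ← ⇓-deterministic d d′ with refl ← ⇓-deterministic e e′ = refl
  ⇓-deterministic (rec d) (rec d′) with refl ← ⇓-deterministic d d′ = refl
  ⇓-deterministic (self d) (self d′) with refl ← ⇓-deterministic d d′ = refl
  ⇓-deterministic (↑ d) (↑ d′) with refl ← ⇓-deterministic d d′ = refl

  Algorithm : Set
  Algorithm = Prog 0

  _on_returns_within_ : Algorithm → Val → Val → ℕ → Set
  A on v returns w within b = ∃[ c ] ([] ⊢ A · v ⇓ w ⟨ c ⟩) × c ℕ.≤ b

  ⌜_⌝₂ : ℕᵇ → Val
  ⌜ ℕᵇ.zero ⌝₂ = nil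
  ⌜ 2[1+ b ] ⌝₂ = ⌜ false ⌝ᵇ ∙ ⌜ b ⌝₂
  ⌜ 1+[2 b ] ⌝₂ = ⌜ true ⌝ᵇ ∙ ⌜ b ⌝₂

  ⌜_⌝ℕ : ℕ → Val
  ⌜ n ⌝ℕ = ⌜ ℕᵇ.fromℕ n ⌝₂

  ⌜_⌝ᵗ : ∀ {n} → RDT n → Val
  ⌜ leaf v ⌝ᵗ      = ⌜ 0 ⌝ℕ ∙ scalar (value v)
  ⌜ query i l r ⌝ᵗ = ⌜ 1 ⌝ℕ ∙ ⌜ toℕ i ⌝ℕ ∙ ⌜ l ⌝ᵗ ∙ ⌜ r ⌝ᵗ
  ⌜ random l r ⌝ᵗ  = ⌜ 2 ⌝ℕ ∙ ⌜ l ⌝ᵗ ∙ ⌜ r ⌝ᵗ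

  -- The number of variables, in binary, is part of the description.
  ⌜_⌝ : ∀ {n} → RDT n → Val
  ⌜_⌝ {n} T = ⌜ n ⌝ℕ ∙ ⌜ T ⌝ᵗ

  descriptionLength : ∀ {n} → RDT n → ℕ
  descriptionLength T = ∣ ⌜ T ⌝ ∣

  ErrorMetric : Set
  ErrorMetric = ∀ {n} → RDT n → DDT n → [0,1]

  Natural : ErrorMetric → Set
  Natural ℰ = Σ ([0,1] → [0,1] → [0,1]) λ d →
    ∀ {n} (R : RDT n) (D : DDT n) → ℰ R D ≡ 𝔼 λ x → d (μ R x) (evaluate D x)

  _IsConstantMinimizerOf_for_ : [0,1] → ErrorMetric → ∀ {n} → RDT n → Set
  c IsConstantMinimizerOf ℰ for R =
    ∀ c′ → value (ℰ R (constant c)) ≤ value (ℰ R (constant c′))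

  record Efficient (t : ℕ → ℕ) (ℰ : ErrorMetric) : Set where
    field
      error : ∃[ A ] Σ (Poly 3) λ p →
        ∀ {n q} (R : RDT n) (D : DDT n) → queries R ℕ.≤ q →
        A on (⌜ R ⌝ ∙ ⌜ tree D ⌝) returns scalar (value (ℰ R D))
          within ⟦ p ⟧ (t q ∷ descriptionLength R ∷ descriptionLength (tree D) ∷ [])
      minimizer : ∃[ A ] Σ (Poly 2) λ p →
        ∀ {n q} (R : RDT n) → queries R ℕ.≤ q →
        ∃[ c ] c IsConstantMinimizerOf ℰ for R ×
          A on ⌜ R ⌝ returns scalar (value c)
            within ⟦ p ⟧ (t q ∷ descriptionLength R ∷ [])

  _IsOptimalFor_,_,_ : ℕ → ErrorMetric → ∀ {n} → RDT n → Carrier → Set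
  q⋆ IsOptimalFor ℰ , R , ε =
    IsLeast (λ q′ → ∃[ D ] queries (tree D) ℕ.≤ q′ × value (ℰ R D) ≤ ε) q⋆

{-# OPTIONS --safe #-}
-- Fixing x_i splits the error of a tree into the average of its errors on the
-- two restrictions of R.  Hence an optimal tree of depth d is the better of the
-- best constant and the trees that query some x_i and continue with optimal
-- trees of depth d ∸ 1 for both restrictions.  The depths 0, 1, 2, … are tried
-- in turn, so the search ends at q⋆ at the latest.  The recursion costs at most
-- (3 (1 + n)) ^ q⋆ times the cost of one comparison, and this factor is at most
-- 6 (n ^ q⋆) ^ 4, since q⋆ = 0 if n = 0 and q⋆ ≤ 1 if n = 1.
module Submission where

open import Defs
import Algebra.Properties.CommutativeSemigroup as CommutativeSemigroupProperties
open import Algebra.Bundles using (CommutativeRing)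
open import Data.Bool.Base using (Bool; true; false; T; if_then_else_)
open import Data.Empty using (⊥-elim)
open import Data.Fin.Base as Fin using (Fin; toℕ)
open import Data.Fin.Patterns using (0F; 1F; 2F; 3F; 4F)
import Data.Fin.Properties as Finₚ
open import Data.List.Base using (List; []; _∷_; _++_; map; length; allFin; tabulate)
open import Data.List.Membership.Propositional using (_∈_)
open import Data.List.Membership.Propositional.Properties using (∈-allFin)
open import Data.List.Properties using (length-tabulate)
open import Data.List.Relation.Unary.Any using (here; there)
open import Data.Nat.Base as ℕ using (ℕ; zero; suc; _^_; _⊔_)
open import Data.Nat.Binary.Base as ℕᵇ using (2[1+_]; 1+[2_])
import Data.Nat.Binary.Properties as ℕᵇₚ
import Data.Nat.Properties as ℕₚ
open import Data.Nat.Solver using (module +-*-Solver)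
open import Data.Product.Base using (Σ; ∃-syntax; _×_; _,_; proj₁; proj₂)
open import Data.Sum.Base using (inj₁; inj₂)
open import Data.Vec.Base using (Vec; []; _∷_; lookup; _[_]≔_)
import Data.Vec.Properties as Vecₚ
open import Data.Vec.Relation.Binary.Pointwise.Inductive as Pointwise using (Pointwise; []; _∷_)
open import Function.Base using (_∘_)
open import Relation.Binary.PropositionalEquality
open import Relation.Nullary.Decidable using (does; yes; no; dec-true; dec-false)
open import Relation.Nullary.Negation using (¬_)

-- Programs and their running time

-- The budget shapes the search. The description contains `n` only in binary, and n ^ q⋆ is 1 when
-- q⋆ = 0, so writing down all variables is affordable only once 1 ≤ q⋆, where n ≤ n ^ q⋆. Depth 0
-- therefore runs with an empty list of variables, and the full list is produced only after a
-- failure. Nothing relates `size` to the field operations, so the search never calculates with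
-- scalars. It only compares numbers that it is given or that the two oracles return, and the latter
-- are bounded in size because writing an output is charged to the running time. A restriction keeps
-- all n variables, with x_i overwritten, and increases neither the query complexity nor the
-- description length. Hence the oracle bounds for R hold throughout the recursion. An optimal tree
-- for a restriction of R may query x_i again. Below a root that queries x_i it acts as its own
-- restriction, and it must be shown that this loses nothing.

module Machine (𝕂 : Scalars) where
  open Scalars 𝕂 using (Carrier; _≤?_)
  open Theory 𝕂

  1≤∣_∣ : ∀ v → 1 ℕ.≤ ∣ v ∣
  1≤∣ nil ∣      = ℕ.s≤s ℕ.z≤n
  1≤∣ scalar _ ∣ = ℕ.s≤s ℕ.z≤n
  1≤∣ _ ∙ _ ∣    = ℕ.s≤s ℕ.z≤n

  ∣u∣≤∣u∙v∣ : ∀ u v → ∣ u ∣ ℕ.≤ ∣ u ∙ v ∣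
  ∣u∣≤∣u∙v∣ u v = ℕₚ.m≤n⇒m≤1+n (ℕₚ.m≤m+n ∣ u ∣ ∣ v ∣)

  ∣v∣≤∣u∙v∣ : ∀ u v → ∣ v ∣ ℕ.≤ ∣ u ∙ v ∣
  ∣v∣≤∣u∙v∣ u v = ℕₚ.m≤n⇒m≤1+n (ℕₚ.m≤n+m ∣ v ∣ ∣ u ∣)

  ∙-mono : ∀ u v {a b} → ∣ u ∣ ℕ.≤ a → ∣ v ∣ ℕ.≤ b → ∣ u ∙ v ∣ ℕ.≤ suc (a ℕ.+ b)
  ∙-mono u v p q = ℕ.s≤s (ℕₚ.+-mono-≤ p q)

  ∣⌜⌝ᵇ∣≤3 : ∀ b → ∣ ⌜ b ⌝ᵇ ∣ ℕ.≤ 3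
  ∣⌜⌝ᵇ∣≤3 false = ℕ.s≤s ℕ.z≤n
  ∣⌜⌝ᵇ∣≤3 true  = ℕₚ.≤-refl

  -- Arithmetic is left out because `size` is an arbitrary function on scalars, so the size of a sum
  -- or product has no bound in terms of its arguments.
  data NonExpanding : Op → Set where
    fst   : NonExpanding fst
    snd   : NonExpanding snd
    pair? : NonExpanding pair?
    leq   : NonExpanding leq

  ∣apply∣≤ : ∀ {o} → NonExpanding o → ∀ v → ∣ apply o v ∣ ℕ.≤ ∣ v ∣
  ∣apply∣≤ fst nil = ℕₚ.≤-refl
  ∣apply∣≤ fst (scalar _) = ℕ.s≤s ℕ.z≤n
  ∣apply∣≤ fst (u ∙ v) = ∣u∣≤∣u∙v∣ u v
  ∣apply∣≤ snd nil = ℕₚ.≤-refl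
  ∣apply∣≤ snd (scalar _) = ℕ.s≤s ℕ.z≤n
  ∣apply∣≤ snd (u ∙ v) = ∣v∣≤∣u∙v∣ u v
  ∣apply∣≤ pair? nil = ℕₚ.≤-refl
  ∣apply∣≤ pair? (scalar _) = ℕ.s≤s ℕ.z≤n
  ∣apply∣≤ pair? (u ∙ v) = ℕ.s≤s (ℕₚ.+-mono-≤ 1≤∣ u ∣ 1≤∣ v ∣)
  ∣apply∣≤ leq nil = ℕₚ.≤-refl
  ∣apply∣≤ leq (scalar _) = ℕ.s≤s ℕ.z≤n
  ∣apply∣≤ leq (nil ∙ _) = ℕ.s≤s ℕ.z≤n
  ∣apply∣≤ leq ((_ ∙ _) ∙ _) = ℕ.s≤s ℕ.z≤n
  ∣apply∣≤ leq (scalar _ ∙ nil) = ℕ.s≤s ℕ.z≤n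
  ∣apply∣≤ leq (scalar _ ∙ (_ ∙ _)) = ℕ.s≤s ℕ.z≤n
  ∣apply∣≤ leq (scalar a ∙ scalar b) = ℕₚ.≤-trans (∣⌜⌝ᵇ∣≤3 (does (a ≤? b)))
    (ℕ.s≤s (ℕₚ.+-mono-≤ 1≤∣ scalar a ∣ 1≤∣ scalar b ∣))

  -- Straight-line programs, which the type checker runs by itself.
  data Line : Set where
    arg  : Line
    lit  : Val → Line
    _▷_  : Line → ∀ {o} → NonExpanding o → Line
    _&_  : Line → Line → Line
  infixl 7 _▷_
  infixr 5 _&_

  ⌊_⌋ : ∀ {k} → Line → Prog k
  ⌊ arg ⌋         = prim id
  ⌊ lit w ⌋       = const w
  ⌊ _▷_ l {o} _ ⌋ = ⌊ l ⌋ ⨾ prim o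
  ⌊ l & m ⌋       = ⟨ ⌊ l ⌋ , ⌊ m ⌋ ⟩

  eval : Line → Val → Val
  eval arg u         = u
  eval (lit w) u     = w
  eval (_▷_ l {o} _) u = apply o (eval l u)
  eval (l & m) u     = eval l u ∙ eval m u

  -- In `l ▷ _` the five summands of the cost are each at most the cost of `l`, which already pays
  -- for reading the input and writing the argument of the operation. In `l & m` sizes and costs
  -- together are at most twice the two costs.
  weight : Line → ℕ
  weight arg     = 2
  weight (lit w) = 1 ℕ.+ ∣ w ∣
  weight (l ▷ _) = weight l ℕ.* 5
  weight (l & m) = (weight l ℕ.+ weight m) ℕ.* 2

  module _ {k} {ρ : Env k} where

    -- Every rule charges for the value read and the value written. This is the only source of size
    -- bounds for the scalars that an oracle returns.
    io≤cost : ∀ {p u v c} → ρ ⊢ p · u ⇓ v ⟨ c ⟩ → ∣ u ∣ ℕ.+ ∣ v ∣ ℕ.≤ c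
    io≤cost const        = ℕₚ.≤-refl
    io≤cost prim         = ℕₚ.≤-refl
    io≤cost (seq _ _)    = ℕₚ.m≤m+n _ _
    io≤cost (fork _ _)   = ℕₚ.m≤m+n _ _
    io≤cost (then _ _ _) = ℕₚ.m≤m+n _ _
    io≤cost (else _ _)   = ℕₚ.m≤m+n _ _
    io≤cost (rec _)      = ℕₚ.m≤m+n _ _
    io≤cost (self _)     = ℕₚ.m≤m+n _ _
    io≤cost (↑ _)        = ℕₚ.m≤m+n _ _

    input≤cost : ∀ {p u v c} → ρ ⊢ p · u ⇓ v ⟨ c ⟩ → ∣ u ∣ ℕ.≤ c
    input≤cost d = ℕₚ.m+n≤o⇒m≤o _ (io≤cost d)

    output≤cost : ∀ {p u v c} → ρ ⊢ p · u ⇓ v ⟨ c ⟩ → ∣ v ∣ ℕ.≤ c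
    output≤cost {u = u} d = ℕₚ.m+n≤o⇒n≤o ∣ u ∣ (io≤cost d)

    line-⇓ : ∀ l u → ∃[ c ] (ρ ⊢ ⌊ l ⌋ · u ⇓ eval l u ⟨ c ⟩) × c ℕ.≤ ∣ u ∣ ℕ.* weight l
    line-⇓ arg u = _ , prim ,
      ℕₚ.≤-reflexive (solve 1 (λ x → x :+ x := x :* con 2) refl ∣ u ∣)
      where open +-*-Solver
    line-⇓ (lit w) u = _ , const , (begin
      ∣ u ∣ ℕ.+ ∣ w ∣             ≤⟨ ℕₚ.+-monoʳ-≤ ∣ u ∣
          (ℕₚ.m≤n*m ∣ w ∣ ∣ u ∣ {{ℕ.>-nonZero 1≤∣ u ∣}}) ⟩
      ∣ u ∣ ℕ.+ ∣ u ∣ ℕ.* ∣ w ∣   ≡⟨ ℕₚ.*-suc ∣ u ∣ ∣ w ∣ ⟨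
      ∣ u ∣ ℕ.* suc ∣ w ∣         ∎)
      where open ℕₚ.≤-Reasoning
    line-⇓ (_▷_ l {o} s) u with line-⇓ l u
    ... | c , d , c≤ = _ , seq d prim , (begin
      ∣ u ∣ ℕ.+ ∣ w ∣ ℕ.+ (c ℕ.+ (∣ v ∣ ℕ.+ ∣ w ∣))
        ≤⟨ ℕₚ.+-mono-≤ (ℕₚ.+-mono-≤ (input≤cost d) w≤c)
             (ℕₚ.+-monoʳ-≤ c (ℕₚ.+-mono-≤ (output≤cost d) w≤c)) ⟩
      c ℕ.+ c ℕ.+ (c ℕ.+ (c ℕ.+ c))
        ≡⟨ solve 1 (λ x → x :+ x :+ (x :+ (x :+ x)) := x :* con 5) refl c ⟩
      c ℕ.* 5
        ≤⟨ ℕₚ.*-monoˡ-≤ 5 c≤ ⟩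
      ∣ u ∣ ℕ.* weight l ℕ.* 5
        ≡⟨ ℕₚ.*-assoc ∣ u ∣ (weight l) 5 ⟩
      ∣ u ∣ ℕ.* (weight l ℕ.* 5) ∎)
      where
      open ℕₚ.≤-Reasoning
      open +-*-Solver
      v = eval l u
      w = apply o v
      w≤c = ℕₚ.≤-trans (∣apply∣≤ s v) (output≤cost d)
    line-⇓ (l & m) u with line-⇓ l u | line-⇓ m u
    ... | c , d , c≤ | c′ , d′ , c′≤ = _ , fork d d′ , (begin
      ∣ u ∣ ℕ.+ suc (∣ v ∣ ℕ.+ ∣ w ∣) ℕ.+ (c ℕ.+ c′)
        ≤⟨ ℕₚ.+-monoˡ-≤ (c ℕ.+ c′) (ℕₚ.+-monoʳ-≤ ∣ u ∣ (ℕₚ.+-monoˡ-≤ (∣ v ∣ ℕ.+ ∣ w ∣) 1≤∣ u ∣)) ⟩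
      ∣ u ∣ ℕ.+ (∣ u ∣ ℕ.+ (∣ v ∣ ℕ.+ ∣ w ∣)) ℕ.+ (c ℕ.+ c′)
        ≡⟨ solve 4 (λ x y z t → x :+ (x :+ (y :+ z)) :+ t := (x :+ y) :+ (x :+ z) :+ t)
             refl (∣ u ∣) (∣ v ∣) (∣ w ∣) (c ℕ.+ c′) ⟩
      (∣ u ∣ ℕ.+ ∣ v ∣) ℕ.+ (∣ u ∣ ℕ.+ ∣ w ∣) ℕ.+ (c ℕ.+ c′)
        ≤⟨ ℕₚ.+-monoˡ-≤ (c ℕ.+ c′) (ℕₚ.+-mono-≤ (io≤cost d) (io≤cost d′)) ⟩
      (c ℕ.+ c′) ℕ.+ (c ℕ.+ c′)
        ≡⟨ solve 1 (λ x → x :+ x := x :* con 2) refl (c ℕ.+ c′) ⟩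
      (c ℕ.+ c′) ℕ.* 2
        ≤⟨ ℕₚ.*-monoˡ-≤ 2 (ℕₚ.+-mono-≤ c≤ c′≤) ⟩
      (∣ u ∣ ℕ.* weight l ℕ.+ ∣ u ∣ ℕ.* weight m) ℕ.* 2
        ≡⟨ solve 3 (λ x y z → (x :* y :+ x :* z) :* con 2 := x :* ((y :+ z) :* con 2))
             refl (∣ u ∣) (weight l) (weight m) ⟩
      ∣ u ∣ ℕ.* ((weight l ℕ.+ weight m) ℕ.* 2) ∎)
      where
      open ℕₚ.≤-Reasoning
      open +-*-Solver
      v = eval l u
      w = eval m u

  -- The cost of a run whose input and output have size at most S is split into
  -- a multiple a of S, a numeral in all uses, and a symbolic remainder x.
  record Run {k} (S : ℕ) (ρ : Env k) (p : Prog k) (u w : Val) (a x : ℕ) : Set where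
    field
      bounded : ∣ u ∣ ℕ.≤ S → ∣ w ∣ ℕ.≤ S →
                ∃[ c ] (ρ ⊢ p · u ⇓ w ⟨ c ⟩) × c ℕ.≤ S ℕ.* a ℕ.+ x
  open Run public

  -- Exceeds the overhead of one pass through the body of any program below.
  opaque
    unit : ℕ
    unit = 100000

    ≤unit : ∀ a → T (a ℕ.≤ᵇ 100000) → a ℕ.≤ unit
    ≤unit a = ℕₚ.≤ᵇ⇒≤ a 100000

  module _ {S : ℕ} where

    node₁ : ∀ {m n c a x} → m ℕ.≤ S → n ℕ.≤ S → c ℕ.≤ S ℕ.* a ℕ.+ x →
            m ℕ.+ n ℕ.+ c ℕ.≤ S ℕ.* (2 ℕ.+ a) ℕ.+ x
    node₁ {a = a} {x} m≤ n≤ c≤ = ℕₚ.≤-trans (ℕₚ.+-mono-≤ (ℕₚ.+-mono-≤ m≤ n≤) c≤)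
      (ℕₚ.≤-reflexive (solve 3 (λ s a x → s :+ s :+ (s :* a :+ x) := s :* (con 2 :+ a) :+ x)
        refl S a x))
      where open +-*-Solver

    node₂ : ∀ {m n c c′ a b x y} → m ℕ.≤ S → n ℕ.≤ S →
            c ℕ.≤ S ℕ.* a ℕ.+ x → c′ ℕ.≤ S ℕ.* b ℕ.+ y →
            m ℕ.+ n ℕ.+ (c ℕ.+ c′) ℕ.≤ S ℕ.* (2 ℕ.+ (a ℕ.+ b)) ℕ.+ (x ℕ.+ y)
    node₂ {a = a} {b} {x} {y} m≤ n≤ c≤ c′≤ = node₁ {a = a ℕ.+ b} m≤ n≤
      (ℕₚ.≤-trans (ℕₚ.+-mono-≤ c≤ c′≤)
        (ℕₚ.≤-reflexive
          (solve 5 (λ s a b x y → s :* a :+ x :+ (s :* b :+ y) := s :* (a :+ b) :+ (x :+ y))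
          refl S a b x y)))
      where open +-*-Solver

    relax : ∀ {k} {ρ : Env k} {p u w a x b y} →
            (∣ u ∣ ℕ.≤ S → ∣ w ∣ ℕ.≤ S → S ℕ.* a ℕ.+ x ℕ.≤ S ℕ.* b ℕ.+ y) →
            Run S ρ p u w a x → Run S ρ p u w b y
    relax f d .bounded u≤ w≤ with d .bounded u≤ w≤
    ... | c , e , c≤ = c , e , ℕₚ.≤-trans c≤ (f u≤ w≤)

    runLine : ∀ {k} {ρ : Env k} l {u} → Run S ρ ⌊ l ⌋ u (eval l u) (weight l) 0
    runLine l {u} .bounded u≤ _ with line-⇓ l u
    ... | c , d , c≤ =
        c , d , ℕₚ.≤-trans c≤ (ℕₚ.≤-trans (ℕₚ.*-monoˡ-≤ (weight l) u≤) (ℕₚ.m≤m+n _ 0))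

    runSeq : ∀ {k} {ρ : Env k} {p q u v w a b x y} → ∣ v ∣ ℕ.≤ S →
             Run S ρ p u v a x → Run S ρ q v w b y →
             Run S ρ (p ⨾ q) u w (2 ℕ.+ (a ℕ.+ b)) (x ℕ.+ y)
    runSeq {a = a} v≤ d e .bounded u≤ w≤ with d .bounded u≤ v≤ | e .bounded v≤ w≤
    ... | _ , d′ , c≤ | _ , e′ , c′≤ = _ , seq d′ e′ , node₂ {a = a} u≤ w≤ c≤ c′≤

    runFork : ∀ {k} {ρ : Env k} {p q u v w a b x y} →
              Run S ρ p u v a x → Run S ρ q u w b y →
              Run S ρ ⟨ p , q ⟩ u (v ∙ w) (2 ℕ.+ (a ℕ.+ b)) (x ℕ.+ y)
    runFork {v = v} {w} {a = a} d e .bounded u≤ vw≤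
      with d .bounded u≤ (ℕₚ.≤-trans (∣u∣≤∣u∙v∣ v w) vw≤)
         | e .bounded u≤ (ℕₚ.≤-trans (∣v∣≤∣u∙v∣ v w) vw≤)
    ... | _ , d′ , c≤ | _ , e′ , c′≤ = _ , fork d′ e′ , node₂ {a = a} u≤ vw≤ c≤ c′≤

    runThen : ∀ {k} {ρ : Env k} {t p q u v v′ w a b x y} → ∣ v ∙ v′ ∣ ℕ.≤ S →
              Run S ρ t u (v ∙ v′) a x → Run S ρ p u w b y →
              Run S ρ (ifte t p q) u w (2 ℕ.+ (a ℕ.+ b)) (x ℕ.+ y)
    runThen {a = a} v≤ d e .bounded u≤ w≤ with d .bounded u≤ v≤ | e .bounded u≤ w≤
    ... | _ , d′ , c≤ | _ , e′ , c′≤ = _ , then d′ (λ ()) e′ , node₂ {a = a} u≤ w≤ c≤ c′≤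

    runElse : ∀ {k} {ρ : Env k} {t p q u w a b x y} →
              Run S ρ t u nil a x → Run S ρ q u w b y →
              Run S ρ (ifte t p q) u w (2 ℕ.+ (a ℕ.+ b)) (x ℕ.+ y)
    runElse {u = u} {a = a} d e .bounded u≤ w≤
      with d .bounded u≤ (ℕₚ.≤-trans 1≤∣ u ∣ u≤) | e .bounded u≤ w≤
    ... | _ , d′ , c≤ | _ , e′ , c′≤ = _ , else d′ e′ , node₂ {a = a} u≤ w≤ c≤ c′≤

    runRec : ∀ {k} {ρ : Env k} {p u w a x} → Run S (ρ ▹ p) p u w a x →
             Run S ρ (rec p) u w (2 ℕ.+ a) x
    runRec {a = a} d .bounded u≤ w≤ with d .bounded u≤ w≤
    ... | _ , d′ , c≤ = _ , rec d′ , node₁ {a = a} u≤ w≤ c≤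

    runSelf : ∀ {k} {ρ : Env k} {p u w a x} → Run S (ρ ▹ p) p u w a x →
              Run S (ρ ▹ p) self u w (2 ℕ.+ a) x
    runSelf {a = a} d .bounded u≤ w≤ with d .bounded u≤ w≤
    ... | _ , d′ , c≤ = _ , self d′ , node₁ {a = a} u≤ w≤ c≤

    run↑ : ∀ {k} {ρ : Env k} {p q u w a x} → Run S ρ p u w a x →
           Run S (ρ ▹ q) (↑ p) u w (2 ℕ.+ a) x
    run↑ {a = a} d .bounded u≤ w≤ with d .bounded u≤ w≤
    ... | _ , d′ , c≤ = _ , ↑ d′ , node₁ {a = a} u≤ w≤ c≤

    runAlgorithm : ∀ {A u w b} → A on u returns w within b → Run S [] A u w 0 b
    runAlgorithm (c , d , c≤) .bounded _ _ = c , d , ℕₚ.≤-trans c≤ (ℕₚ.m≤n+m _ (S ℕ.* 0))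

    -- Makes the size bounds on input and output available while a run is assembled, where they
    -- bound the components passed to recursive calls.
    assuming : ∀ {k} {ρ : Env k} {p u w a x} →
               (∣ u ∣ ℕ.≤ S → ∣ w ∣ ℕ.≤ S → Run S ρ p u w a x) → Run S ρ p u w a x
    assuming f .bounded u≤ w≤ = f u≤ w≤ .bounded u≤ w≤

    -- For a concrete program `a` is a closed numeral, so the implicit test is settled by
    -- evaluation. From here on the overhead is one opaque `unit`, and later estimates stay
    -- symbolic.
    absorb : ∀ {k} {ρ : Env k} {p u w a x y} {_ : T (a ℕ.≤ᵇ 100000)} →
             S ℕ.* unit ℕ.+ x ℕ.≤ y → Run S ρ p u w a x → Run S ρ p u w 0 y
    absorb {a = a} {x} {y} {a≤} h = relax λ _ _ → (begin
      S ℕ.* a ℕ.+ x    ≤⟨ ℕₚ.+-monoˡ-≤ x (ℕₚ.*-monoʳ-≤ S (≤unit a a≤)) ⟩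
      S ℕ.* unit ℕ.+ x ≤⟨ h ⟩
      y                ≤⟨ ℕₚ.m≤n+m y (S ℕ.* 0) ⟩
      S ℕ.* 0 ℕ.+ y    ∎)
      where open ℕₚ.≤-Reasoning

  iterate : ∀ S m {m′} → suc m ℕ.≤ m′ →
            S ℕ.* unit ℕ.+ S ℕ.* (m ℕ.* unit) ℕ.≤ S ℕ.* (m′ ℕ.* unit)
  iterate S m {m′} h = begin
    S ℕ.* unit ℕ.+ S ℕ.* (m ℕ.* unit) ≡⟨ ℕₚ.*-distribˡ-+ S unit (m ℕ.* unit) ⟨
    S ℕ.* (suc m ℕ.* unit)            ≤⟨ ℕₚ.*-monoʳ-≤ S (ℕₚ.*-monoˡ-≤ unit h) ⟩
    S ℕ.* (m′ ℕ.* unit)               ∎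
    where open ℕₚ.≤-Reasoning

  -- Programs for numerals, for the list of variables and for restrictions

  hd tl : Line → Line
  hd l = l ▷ fst
  tl l = l ▷ snd

  eqBody : ∀ {k} → Prog (suc k)
  eqBody =
    ifte ⌊ hd arg ▷ pair? ⌋
      (ifte ⌊ tl arg ▷ pair? ⌋
        (ifte ⌊ hd (hd arg) ⌋
          (ifte ⌊ hd (tl arg) ⌋ (⌊ tl (hd arg) & tl (tl arg) ⌋ ⨾ self) ⌊ lit nil ⌋)
          (ifte ⌊ hd (tl arg) ⌋ ⌊ lit nil ⌋ (⌊ tl (hd arg) & tl (tl arg) ⌋ ⨾ self)))
        ⌊ lit nil ⌋)
      (ifte ⌊ tl arg ▷ pair? ⌋ ⌊ lit nil ⌋ ⌊ lit ⌜ true ⌝ᵇ ⌋)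

  eq : ∀ {k} → Prog k
  eq = rec eqBody

  -- Numerals are in bijective base 2, least digit first: a digit 1 becomes 2, and a digit 2 becomes
  -- 1 with a carry.
  sucBody : ∀ {k} → Prog (suc k)
  sucBody =
    ifte ⌊ arg ▷ pair? ⌋
      (ifte ⌊ hd arg ⌋ ⌊ lit ⌜ false ⌝ᵇ & tl arg ⌋ ⟨ ⌊ lit ⌜ true ⌝ᵇ ⌋ , ⌊ tl arg ⌋ ⨾ self ⟩)
      ⌊ lit (⌜ true ⌝ᵇ ∙ nil) ⌋

  increment : ∀ {k} → Prog k
  increment = rec sucBody

  ⌜_⌝ˡ : ∀ {n} → List (Fin n) → Val
  ⌜ [] ⌝ˡ    = nil
  ⌜ i ∷ M ⌝ˡ = ⌜ toℕ i ⌝ℕ ∙ ⌜ M ⌝ˡ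

  -- Indices are compared through their binary codes, as the program does.
  restrict : ∀ {n} → Fin n → Bool → RDT n → RDT n
  restrict i b (leaf v)      = leaf v
  restrict i b (query j l r) =
    if does (ℕᵇ.fromℕ (toℕ i) ℕᵇₚ.≟ ℕᵇ.fromℕ (toℕ j))
      then (if b then restrict i b r else restrict i b l)
      else query j (restrict i b l) (restrict i b r)
  restrict i b (random l r)  = random (restrict i b l) (restrict i b r)

  rangeBody : ∀ {k} → Prog (suc k)
  rangeBody = ifte eq ⌊ lit nil ⌋
    ⟨ ⌊ hd arg ⌋ , ⟨ ⌊ hd arg ⌋ ⨾ increment , ⌊ tl arg ⌋ ⟩ ⨾ self ⟩

  range : ∀ {k} → Prog k
  range = rec rangeBody

  -- The tags 0, 1 and 2 are coded as `nil`, a pair with head other than `nil`, and a pair with head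
  -- `nil`. Two tests thus separate leaves, queries and random nodes.
  restrictBody : ∀ {k} → Prog (suc k)
  restrictBody =
    ifte ⌊ tag ▷ pair? ⌋
      (ifte ⌊ hd tag ⌋
        (ifte (⌊ hd (tl arg) & hd rest ⌋ ⨾ eq)
          (ifte ⌊ hd arg ⌋ (⌊ with-tree (tl (tl rest)) ⌋ ⨾ self)
            (⌊ with-tree (hd (tl rest)) ⌋ ⨾ self))
          ⟨ ⌊ tag ⌋ , ⟨ ⌊ hd rest ⌋ ,
            ⟨ ⌊ with-tree (hd (tl rest)) ⌋ ⨾ self , ⌊ with-tree (tl (tl rest)) ⌋ ⨾ self ⟩ ⟩ ⟩)
        ⟨ ⌊ tag ⌋ , ⟨ ⌊ with-tree (hd rest) ⌋ ⨾ self , ⌊ with-tree (tl rest) ⌋ ⨾ self ⟩ ⟩)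
      ⌊ tl (tl arg) ⌋
    where
    tag rest : Line
    tag  = hd (tl (tl arg))
    rest = tl (tl (tl arg))
    with-tree : Line → Line
    with-tree l = hd arg & hd (tl arg) & l

  restriction : ∀ {k} → Prog k
  restriction = rec restrictBody

  -- Correctness and running time of these programs

  fromℕ-suc : ∀ n → ℕᵇ.fromℕ (suc n) ≡ ℕᵇ.suc (ℕᵇ.fromℕ n)
  fromℕ-suc n = trans (ℕᵇₚ.fromℕ≡fromℕ' (suc n)) (cong ℕᵇ.suc (sym (ℕᵇₚ.fromℕ≡fromℕ' n)))

  module _ {S : ℕ} (3≤S : 3 ℕ.≤ S) where

    S≤once : ∀ v → S ℕ.* unit ℕ.+ 0 ℕ.≤ S ℕ.* (∣ v ∣ ℕ.* unit)
    S≤once v = ℕₚ.≤-trans (ℕₚ.≤-reflexive (ℕₚ.+-identityʳ _))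
      (ℕₚ.*-monoʳ-≤ S (ℕₚ.m≤n*m unit ∣ v ∣ {{ℕ.>-nonZero 1≤∣ v ∣}}))

    runEqBody : ∀ {k} {ρ : Env k} x y →
      Run S (ρ ▹ eqBody) eqBody (⌜ x ⌝₂ ∙ ⌜ y ⌝₂) ⌜ does (x ℕᵇₚ.≟ y) ⌝ᵇ 0
          (S ℕ.* (∣ ⌜ x ⌝₂ ∣ ℕ.* unit))
    runEqBody ℕᵇ.zero ℕᵇ.zero = absorb (S≤once nil)
      (runElse (runLine (hd arg ▷ pair?))
        (runElse (runLine (tl arg ▷ pair?)) (runLine (lit ⌜ true ⌝ᵇ))))
    runEqBody ℕᵇ.zero 2[1+ y ] = absorb (S≤once nil)
      (runElse (runLine (hd arg ▷ pair?))
        (runThen 3≤S (runLine (tl arg ▷ pair?)) (runLine (lit nil))))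
    runEqBody ℕᵇ.zero 1+[2 y ] = absorb (S≤once nil)
      (runElse (runLine (hd arg ▷ pair?))
        (runThen 3≤S (runLine (tl arg ▷ pair?)) (runLine (lit nil))))
    runEqBody 2[1+ x ] ℕᵇ.zero = absorb (S≤once ⌜ 2[1+ x ] ⌝₂)
      (runThen 3≤S (runLine (hd arg ▷ pair?))
        (runElse (runLine (tl arg ▷ pair?)) (runLine (lit nil))))
    runEqBody 1+[2 x ] ℕᵇ.zero = absorb (S≤once ⌜ 1+[2 x ] ⌝₂)
      (runThen 3≤S (runLine (hd arg ▷ pair?))
        (runElse (runLine (tl arg ▷ pair?)) (runLine (lit nil))))
    runEqBody 2[1+ x ] 1+[2 y ] = absorb (S≤once ⌜ 2[1+ x ] ⌝₂)
      (runThen 3≤S (runLine (hd arg ▷ pair?)) (runThen 3≤S (runLine (tl arg ▷ pair?))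
        (runElse (runLine (hd (hd arg)))
          (runThen 3≤S (runLine (hd (tl arg))) (runLine (lit nil))))))
    runEqBody 1+[2 x ] 2[1+ y ] = absorb (S≤once ⌜ 1+[2 x ] ⌝₂)
      (runThen 3≤S (runLine (hd arg ▷ pair?)) (runThen 3≤S (runLine (tl arg ▷ pair?))
        (runThen 3≤S (runLine (hd (hd arg)))
          (runElse (runLine (hd (tl arg))) (runLine (lit nil))))))
    runEqBody 2[1+ x ] 2[1+ y ] = assuming λ u≤ _ →
      absorb (iterate S ∣ ⌜ x ⌝₂ ∣ (ℕ.s≤s (ℕₚ.n≤1+n _)))
      (runThen 3≤S (runLine (hd arg ▷ pair?)) (runThen 3≤S (runLine (tl arg ▷ pair?))
        (runElse (runLine (hd (hd arg))) (runElse (runLine (hd (tl arg)))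
          (runSeq (tails≤ (⌜ false ⌝ᵇ) (⌜ false ⌝ᵇ) u≤) (runLine (tl (hd arg) & tl (tl arg)))
            (runSelf (runEqBody x y)))))))
      where
      tails≤ : ∀ b c → ∣ (b ∙ ⌜ x ⌝₂) ∙ c ∙ ⌜ y ⌝₂ ∣ ℕ.≤ S → ∣ ⌜ x ⌝₂ ∙ ⌜ y ⌝₂ ∣ ℕ.≤ S
      tails≤ b c = ℕₚ.≤-trans (∙-mono ⌜ x ⌝₂ ⌜ y ⌝₂ (∣v∣≤∣u∙v∣ b _) (∣v∣≤∣u∙v∣ c _))
    runEqBody 1+[2 x ] 1+[2 y ] = assuming λ u≤ _ →
      absorb (iterate S ∣ ⌜ x ⌝₂ ∣ (ℕ.s≤s (ℕₚ.m≤n+m _ 3)))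
      (runThen 3≤S (runLine (hd arg ▷ pair?)) (runThen 3≤S (runLine (tl arg ▷ pair?))
        (runThen 3≤S (runLine (hd (hd arg))) (runThen 3≤S (runLine (hd (tl arg)))
          (runSeq (tails≤ (⌜ true ⌝ᵇ) (⌜ true ⌝ᵇ) u≤) (runLine (tl (hd arg) & tl (tl arg)))
            (runSelf (runEqBody x y)))))))
      where
      tails≤ : ∀ b c → ∣ (b ∙ ⌜ x ⌝₂) ∙ c ∙ ⌜ y ⌝₂ ∣ ℕ.≤ S → ∣ ⌜ x ⌝₂ ∙ ⌜ y ⌝₂ ∣ ℕ.≤ S
      tails≤ b c = ℕₚ.≤-trans (∙-mono ⌜ x ⌝₂ ⌜ y ⌝₂ (∣v∣≤∣u∙v∣ b _) (∣v∣≤∣u∙v∣ c _))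

    runEq : ∀ {k} {ρ : Env k} x y →
      Run S ρ eq (⌜ x ⌝₂ ∙ ⌜ y ⌝₂) ⌜ does (x ℕᵇₚ.≟ y) ⌝ᵇ 2 (S ℕ.* (∣ ⌜ x ⌝₂ ∣ ℕ.* unit))
    runEq x y = runRec (runEqBody x y)

    runSucBody : ∀ {k} {ρ : Env k} x →
      Run S (ρ ▹ sucBody) sucBody ⌜ x ⌝₂ ⌜ ℕᵇ.suc x ⌝₂ 0 (S ℕ.* (∣ ⌜ x ⌝₂ ∣ ℕ.* unit))
    runSucBody ℕᵇ.zero = absorb (S≤once nil)
      (runElse (runLine (arg ▷ pair?)) (runLine (lit (⌜ true ⌝ᵇ ∙ nil))))
    runSucBody 1+[2 x ] = absorb (S≤once ⌜ 1+[2 x ] ⌝₂)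
      (runThen 3≤S (runLine (arg ▷ pair?))
        (runThen 3≤S (runLine (hd arg)) (runLine (lit ⌜ false ⌝ᵇ & tl arg))))
    runSucBody 2[1+ x ] = assuming λ u≤ _ →
      absorb (iterate S ∣ ⌜ x ⌝₂ ∣ (ℕ.s≤s (ℕₚ.n≤1+n _)))
      (runThen 3≤S (runLine (arg ▷ pair?)) (runElse (runLine (hd arg))
        (runFork (runLine (lit ⌜ true ⌝ᵇ))
          (runSeq (ℕₚ.≤-trans (∣v∣≤∣u∙v∣ nil ⌜ x ⌝₂) u≤) (runLine (tl arg))
            (runSelf (runSucBody x))))))

    runIncrement : ∀ {k} {ρ : Env k} x →
      Run S ρ increment ⌜ x ⌝₂ ⌜ ℕᵇ.suc x ⌝₂ 2 (S ℕ.* (∣ ⌜ x ⌝₂ ∣ ℕ.* unit))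
    runIncrement x = runRec (runSucBody x)

    runEqTrue : ∀ {k} {ρ : Env k} i j → i ≡ j →
      Run S ρ eq (⌜ i ⌝ℕ ∙ ⌜ j ⌝ℕ) ⌜ true ⌝ᵇ 2 (S ℕ.* (∣ ⌜ i ⌝ℕ ∣ ℕ.* unit))
    runEqTrue {ρ = ρ} i j i≡j =
        subst (λ b → Run S ρ eq (⌜ i ⌝ℕ ∙ ⌜ j ⌝ℕ) ⌜ b ⌝ᵇ 2 (S ℕ.* (∣ ⌜ i ⌝ℕ ∣ ℕ.* unit)))
      (dec-true (ℕᵇ.fromℕ i ℕᵇₚ.≟ ℕᵇ.fromℕ j) (cong ℕᵇ.fromℕ i≡j)) (runEq (ℕᵇ.fromℕ i) (ℕᵇ.fromℕ j))

    runEqFalse : ∀ {k} {ρ : Env k} i j → i ≢ j →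
      Run S ρ eq (⌜ i ⌝ℕ ∙ ⌜ j ⌝ℕ) nil 2 (S ℕ.* (∣ ⌜ i ⌝ℕ ∣ ℕ.* unit))
    runEqFalse {ρ = ρ} i j i≢j =
        subst (λ b → Run S ρ eq (⌜ i ⌝ℕ ∙ ⌜ j ⌝ℕ) ⌜ b ⌝ᵇ 2 (S ℕ.* (∣ ⌜ i ⌝ℕ ∣ ℕ.* unit)))
      (dec-false (ℕᵇ.fromℕ i ℕᵇₚ.≟ ℕᵇ.fromℕ j) (i≢j ∘ ℕᵇₚ.fromℕ-injective))
        (runEq (ℕᵇ.fromℕ i) (ℕᵇ.fromℕ j))

    runIncrementℕ : ∀ {k} {ρ : Env k} i →
      Run S ρ increment ⌜ i ⌝ℕ ⌜ suc i ⌝ℕ 2 (S ℕ.* (∣ ⌜ i ⌝ℕ ∣ ℕ.* unit))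
    runIncrementℕ {ρ = ρ} i =
        subst (λ x → Run S ρ increment ⌜ i ⌝ℕ ⌜ x ⌝₂ 2 (S ℕ.* (∣ ⌜ i ⌝ℕ ∣ ℕ.* unit)))
            (sym (fromℕ-suc i))
      (runIncrement (ℕᵇ.fromℕ i))

    -- One round of `range` performs an equality test and an increment, each of cost at most S * (S
    -- * unit), since a numeral of size at most S has at most S digits. A node met by `restriction`
    -- needs at most one equality test.
    pass : ℕ
    pass = S ℕ.* unit ℕ.+ (S ℕ.* (S ℕ.* unit) ℕ.+ S ℕ.* (S ℕ.* unit))

    -- The tail of `allFin` is not again an `allFin`, so the induction is over tabulations of any
    -- `f` that counts upwards from `i`, with `m` indices left.
    runRangeBody : ∀ {k} {ρ : Env k} {n} → (∀ i → i ℕ.≤ n → ∣ ⌜ i ⌝ℕ ∙ ⌜ n ⌝ℕ ∣ ℕ.≤ S) →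
      ∀ m i (f : Fin m → Fin n) → (∀ j → toℕ (f j) ≡ i ℕ.+ toℕ j) → i ℕ.+ m ≡ n →
      Run S (ρ ▹ rangeBody) rangeBody (⌜ i ⌝ℕ ∙ ⌜ n ⌝ℕ) ⌜ tabulate f ⌝ˡ 0 (suc m ℕ.* pass)
    runRangeBody {n = n} fits zero i f f≡ i≡n = assuming λ u≤ _ → absorb (bound u≤)
      (runThen 3≤S (runEqTrue i n (trans (sym (ℕₚ.+-identityʳ i)) i≡n))
        (runLine (lit nil)))
      where
      bound : ∣ ⌜ i ⌝ℕ ∙ ⌜ n ⌝ℕ ∣ ℕ.≤ S →
          S ℕ.* unit ℕ.+ (S ℕ.* (∣ ⌜ i ⌝ℕ ∣ ℕ.* unit) ℕ.+ 0) ℕ.≤ pass ℕ.+ 0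
      bound u≤ = ℕₚ.≤-trans
          (ℕₚ.+-monoʳ-≤ (S ℕ.* unit) (ℕₚ.+-mono-≤ (ℕₚ.*-monoʳ-≤ S (ℕₚ.*-monoˡ-≤ unit
        (ℕₚ.≤-trans (∣u∣≤∣u∙v∣ ⌜ i ⌝ℕ ⌜ n ⌝ℕ) u≤))) ℕ.z≤n)) (ℕₚ.m≤m+n pass 0)
    runRangeBody {n = n} fits (suc m) i f f≡ i+1+m≡n = assuming λ u≤ out≤ → absorb (bound u≤)
      (runElse (runEqFalse i n (ℕₚ.<⇒≢ i<n))
        -- The program outputs `i`, whereas the tabulation starts with the value of `f` at zero.
        (subst (λ v → Run S _ _ _ (⌜ v ⌝ℕ ∙ ⌜ tabulate (f ∘ Fin.suc) ⌝ˡ) _ _)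
          (sym (trans (f≡ Fin.zero) (ℕₚ.+-identityʳ i)))
          (runFork (runLine (hd arg))
            (runSeq (fits (suc i) i<n)
              (runFork (runSeq (ℕₚ.≤-trans (∣u∣≤∣u∙v∣ ⌜ i ⌝ℕ ⌜ n ⌝ℕ) u≤) (runLine (hd arg))
                (runIncrementℕ i))
                (runLine (tl arg)))
              (runSelf (runRangeBody fits m (suc i) (f ∘ Fin.suc)
                (λ j → trans (f≡ (Fin.suc j)) (ℕₚ.+-suc i (toℕ j)))
                (trans (sym (ℕₚ.+-suc i m)) i+1+m≡n)))))))
      where
      i<n : i ℕ.< n
      i<n = ℕₚ.≤-trans (ℕₚ.m≤m+n (suc i) m) (ℕₚ.≤-reflexive (trans (sym (ℕₚ.+-suc i m)) i+1+m≡n))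
      bound : ∣ ⌜ i ⌝ℕ ∙ ⌜ n ⌝ℕ ∣ ℕ.≤ S →
        S ℕ.* unit ℕ.+ (S ℕ.* (∣ ⌜ i ⌝ℕ ∣ ℕ.* unit) ℕ.+
          (S ℕ.* (∣ ⌜ i ⌝ℕ ∣ ℕ.* unit) ℕ.+ 0 ℕ.+ suc m ℕ.* pass))
          ℕ.≤ suc (suc m) ℕ.* pass
      bound u≤ = begin
        S ℕ.* unit ℕ.+ (x ℕ.+ (x ℕ.+ 0 ℕ.+ suc m ℕ.* pass))
          ≡⟨ solve 3 (λ s x y → s :+ (x :+ (x :+ con 0 :+ y)) := s :+ (x :+ x) :+ y) refl
              (S ℕ.* unit) x (suc m ℕ.* pass) ⟩
        S ℕ.* unit ℕ.+ (x ℕ.+ x) ℕ.+ suc m ℕ.* pass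
          ≤⟨ ℕₚ.+-monoˡ-≤ (suc m ℕ.* pass) (ℕₚ.+-monoʳ-≤ (S ℕ.* unit) (ℕₚ.+-mono-≤ x≤ x≤)) ⟩
        pass ℕ.+ suc m ℕ.* pass ∎
        where
        open ℕₚ.≤-Reasoning
        open +-*-Solver
        x = S ℕ.* (∣ ⌜ i ⌝ℕ ∣ ℕ.* unit)
        x≤ : x ℕ.≤ S ℕ.* (S ℕ.* unit)
        x≤ = ℕₚ.*-monoʳ-≤ S (ℕₚ.*-monoˡ-≤ unit (ℕₚ.≤-trans (∣u∣≤∣u∙v∣ ⌜ i ⌝ℕ ⌜ n ⌝ℕ) u≤))

    runRange : ∀ {k} {ρ : Env k} n → (∀ i → i ℕ.≤ n → ∣ ⌜ i ⌝ℕ ∙ ⌜ n ⌝ℕ ∣ ℕ.≤ S) →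
      Run S ρ range (nil ∙ ⌜ n ⌝ℕ) ⌜ allFin n ⌝ˡ 2 (suc n ℕ.* pass)
    runRange n fits = runRec (runRangeBody fits n 0 (λ i → i) (λ _ → refl) refl)

    pass-bound : ∀ m {z e x} → e ℕ.≤ S ℕ.* (S ℕ.* unit) → x ℕ.≤ m ℕ.* pass → suc m ℕ.≤ z →
      S ℕ.* unit ℕ.+ (e ℕ.+ x) ℕ.≤ z ℕ.* pass
    pass-bound m {z} {e} {x} e≤ x≤ m<z = begin
      S ℕ.* unit ℕ.+ (e ℕ.+ x) ≡⟨ ℕₚ.+-assoc (S ℕ.* unit) e x ⟨
      S ℕ.* unit ℕ.+ e ℕ.+ x   ≤⟨ ℕₚ.+-mono-≤ (ℕₚ.+-monoʳ-≤ (S ℕ.* unit) (ℕₚ.m≤n⇒m≤n+o _ e≤)) x≤ ⟩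
      suc m ℕ.* pass           ≤⟨ ℕₚ.*-monoˡ-≤ pass m<z ⟩
      z ℕ.* pass               ∎
      where open ℕₚ.≤-Reasoning

    both : ∀ u v → ∣ u ∣ ℕ.* pass ℕ.+ ∣ v ∣ ℕ.* pass ℕ.≤ (∣ u ∣ ℕ.+ ∣ v ∣) ℕ.* pass
    both u v = ℕₚ.≤-reflexive (sym (ℕₚ.*-distribʳ-+ pass ∣ u ∣ ∣ v ∣))

    private module Query {n} (i : Fin n) (b : Bool) (j : Fin n) (l r : RDT n) where
      lr w : Val
      lr = ⌜ l ⌝ᵗ ∙ ⌜ r ⌝ᵗ
      w = ⌜ query j l r ⌝ᵗ

      lr≤ : ∣ lr ∣ ℕ.≤ ∣ w ∣
      lr≤ = ℕₚ.≤-trans (∣v∣≤∣u∙v∣ ⌜ toℕ j ⌝ℕ lr) (∣v∣≤∣u∙v∣ ⌜ 1 ⌝ℕ (⌜ toℕ j ⌝ℕ ∙ lr))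

      l≤ : ∣ ⌜ l ⌝ᵗ ∣ ℕ.≤ ∣ w ∣
      l≤ = ℕₚ.≤-trans (∣u∣≤∣u∙v∣ ⌜ l ⌝ᵗ ⌜ r ⌝ᵗ) lr≤

      r≤ : ∣ ⌜ r ⌝ᵗ ∣ ℕ.≤ ∣ w ∣
      r≤ = ℕₚ.≤-trans (∣v∣≤∣u∙v∣ ⌜ l ⌝ᵗ ⌜ r ⌝ᵗ) lr≤

      ∣l∣+∣r∣≤ : ∣ ⌜ l ⌝ᵗ ∣ ℕ.+ ∣ ⌜ r ⌝ᵗ ∣ ℕ.≤ ∣ ⌜ 1 ⌝ℕ ∣ ℕ.+ ∣ ⌜ toℕ j ⌝ℕ ∙ lr ∣
      ∣l∣+∣r∣≤ = ℕₚ.m≤n⇒m≤o+n ∣ ⌜ 1 ⌝ℕ ∣ (ℕₚ.≤-trans (ℕₚ.n≤1+n _) (∣v∣≤∣u∙v∣ ⌜ toℕ j ⌝ℕ lr))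

      fits : ∣ ⌜ b ⌝ᵇ ∙ ⌜ toℕ i ⌝ℕ ∙ w ∣ ℕ.≤ S → ∣ ⌜ toℕ i ⌝ℕ ∙ ⌜ toℕ j ⌝ℕ ∣ ℕ.≤ S
      fits u≤ = ℕₚ.≤-trans (∙-mono ⌜ toℕ i ⌝ℕ ⌜ toℕ j ⌝ℕ ℕₚ.≤-refl
          (ℕₚ.≤-trans (∣u∣≤∣u∙v∣ ⌜ toℕ j ⌝ℕ lr) (∣v∣≤∣u∙v∣ ⌜ 1 ⌝ℕ (⌜ toℕ j ⌝ℕ ∙ lr))))
        (ℕₚ.≤-trans (∣v∣≤∣u∙v∣ ⌜ b ⌝ᵇ (⌜ toℕ i ⌝ℕ ∙ w)) u≤)

      eq≤ : ∣ ⌜ b ⌝ᵇ ∙ ⌜ toℕ i ⌝ℕ ∙ w ∣ ℕ.≤ S →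
          S ℕ.* (∣ ⌜ toℕ i ⌝ℕ ∣ ℕ.* unit) ℕ.≤ S ℕ.* (S ℕ.* unit)
      eq≤ u≤ = ℕₚ.*-monoʳ-≤ S (ℕₚ.*-monoˡ-≤ unit
        (ℕₚ.≤-trans (∣u∣≤∣u∙v∣ ⌜ toℕ i ⌝ℕ ⌜ toℕ j ⌝ℕ) (fits u≤)))

    -- The code of a node is longer than the codes of its subtrees together. One `pass` per unit of
    -- code size therefore pays for the node and for all recursive calls.
    runRestrictBody : ∀ {k} {ρ : Env k} {n} (i : Fin n) b T →
      Run S (ρ ▹ restrictBody) restrictBody (⌜ b ⌝ᵇ ∙ ⌜ toℕ i ⌝ℕ ∙ ⌜ T ⌝ᵗ) ⌜ restrict i b T ⌝ᵗ 0
          (∣ ⌜ T ⌝ᵗ ∣ ℕ.* pass)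
    runSubtree : ∀ {k} {ρ : Env k} {n} (i : Fin n) b T l w →
      ∣ ⌜ T ⌝ᵗ ∣ ℕ.≤ ∣ w ∣ → ∣ ⌜ b ⌝ᵇ ∙ ⌜ toℕ i ⌝ℕ ∙ w ∣ ℕ.≤ S →
      eval l (⌜ b ⌝ᵇ ∙ ⌜ toℕ i ⌝ℕ ∙ w) ≡ ⌜ T ⌝ᵗ →
      Run S (ρ ▹ restrictBody) (⌊ hd arg & hd (tl arg) & l ⌋ ⨾ self)
          (⌜ b ⌝ᵇ ∙ ⌜ toℕ i ⌝ℕ ∙ w) ⌜ restrict i b T ⌝ᵗ
        (2 ℕ.+ (weight (hd arg & hd (tl arg) & l) ℕ.+ 2)) (∣ ⌜ T ⌝ᵗ ∣ ℕ.* pass)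
    runSubtree {ρ = ρ} i b T l w T≤w u≤ l≡T = runSeq
      (ℕₚ.≤-trans (∙-mono ⌜ b ⌝ᵇ (⌜ toℕ i ⌝ℕ ∙ ⌜ T ⌝ᵗ) ℕₚ.≤-refl
        (∙-mono ⌜ toℕ i ⌝ℕ ⌜ T ⌝ᵗ ℕₚ.≤-refl T≤w)) u≤)
      (subst (λ v → Run S (ρ ▹ restrictBody) ⌊ hd arg & hd (tl arg) & l ⌋ (⌜ b ⌝ᵇ ∙ ⌜ toℕ i ⌝ℕ ∙ w)
          (⌜ b ⌝ᵇ ∙ ⌜ toℕ i ⌝ℕ ∙ v) (weight (hd arg & hd (tl arg) & l)) 0)
        l≡T (runLine (hd arg & hd (tl arg) & l)))
      (runSelf (runRestrictBody i b T))

    runRestrictBody i b (leaf v) = absorb (ℕₚ.≤-trans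
        (ℕₚ.+-monoʳ-≤ (S ℕ.* unit) ℕ.z≤n) (ℕₚ.m≤m+n pass _))
      (runElse (runLine (hd (tl (tl arg)) ▷ pair?)) (runLine (tl (tl arg))))
    runRestrictBody i b (random l r) = assuming λ u≤ _ → absorb
      (pass-bound (∣ ⌜ l ⌝ᵗ ∣ ℕ.+ ∣ ⌜ r ⌝ᵗ ∣) {e = 0} ℕ.z≤n (both ⌜ l ⌝ᵗ ⌜ r ⌝ᵗ)
        (ℕ.s≤s (ℕₚ.m≤n+m _ 4)))
      (runThen 3≤S (runLine (hd (tl (tl arg)) ▷ pair?))
        (runElse (runLine (hd (hd (tl (tl arg)))))
          (runFork (runLine (hd (tl (tl arg))))
            (runFork
              (runSubtree i b l (hd (tl (tl (tl arg)))) w l≤ u≤ refl)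
              (runSubtree i b r (tl (tl (tl (tl arg)))) w r≤ u≤ refl)))))
      where
      w = ⌜ random l r ⌝ᵗ
      l≤ = ℕₚ.≤-trans (∣u∣≤∣u∙v∣ ⌜ l ⌝ᵗ ⌜ r ⌝ᵗ) (∣v∣≤∣u∙v∣ ⌜ 2 ⌝ℕ (⌜ l ⌝ᵗ ∙ ⌜ r ⌝ᵗ))
      r≤ = ℕₚ.≤-trans (∣v∣≤∣u∙v∣ ⌜ l ⌝ᵗ ⌜ r ⌝ᵗ) (∣v∣≤∣u∙v∣ ⌜ 2 ⌝ℕ (⌜ l ⌝ᵗ ∙ ⌜ r ⌝ᵗ))
    runRestrictBody i b (query j l r) with ℕᵇ.fromℕ (toℕ i) ℕᵇₚ.≟ ℕᵇ.fromℕ (toℕ j)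
    ... | no i≢j = assuming λ u≤ _ → absorb
      (pass-bound (∣ ⌜ l ⌝ᵗ ∣ ℕ.+ ∣ ⌜ r ⌝ᵗ ∣) (eq≤ u≤) (both ⌜ l ⌝ᵗ ⌜ r ⌝ᵗ) (ℕ.s≤s ∣l∣+∣r∣≤))
      (runThen 3≤S (runLine (hd (tl (tl arg)) ▷ pair?))
        (runThen 3≤S (runLine (hd (hd (tl (tl arg)))))
          (runElse (runSeq (fits u≤) (runLine (hd (tl arg) & hd (tl (tl (tl arg)))))
            (runEqFalse (toℕ i) (toℕ j) (i≢j ∘ cong ℕᵇ.fromℕ)))
            (runFork (runLine (hd (tl (tl arg))))
              (runFork (runLine (hd (tl (tl (tl arg)))))
                (runFork
                  (runSubtree i b l (hd (tl (tl (tl (tl arg))))) w l≤ u≤ refl)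
                  (runSubtree i b r (tl (tl (tl (tl (tl arg))))) w r≤ u≤ refl)))))))
      where open Query i b j l r
    runRestrictBody i true (query j l r) | yes i≡j = assuming λ u≤ _ → absorb
      (pass-bound ∣ ⌜ r ⌝ᵗ ∣ (eq≤ u≤) ℕₚ.≤-refl
        (ℕ.s≤s (ℕₚ.≤-trans (ℕₚ.m≤n+m _ ∣ ⌜ l ⌝ᵗ ∣) ∣l∣+∣r∣≤)))
      (runThen 3≤S (runLine (hd (tl (tl arg)) ▷ pair?))
        (runThen 3≤S (runLine (hd (hd (tl (tl arg)))))
          (runThen 3≤S (runSeq (fits u≤) (runLine (hd (tl arg) & hd (tl (tl (tl arg)))))
            (runEqTrue (toℕ i) (toℕ j) (ℕᵇₚ.fromℕ-injective i≡j)))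
            (runThen 3≤S (runLine (hd arg))
              (runSubtree i true r (tl (tl (tl (tl (tl arg))))) w r≤ u≤ refl)))))
      where open Query i true j l r
    runRestrictBody i false (query j l r) | yes i≡j = assuming λ u≤ _ → absorb
      (pass-bound ∣ ⌜ l ⌝ᵗ ∣ (eq≤ u≤) ℕₚ.≤-refl
        (ℕ.s≤s (ℕₚ.≤-trans (ℕₚ.m≤m+n _ ∣ ⌜ r ⌝ᵗ ∣) ∣l∣+∣r∣≤)))
      (runThen 3≤S (runLine (hd (tl (tl arg)) ▷ pair?))
        (runThen 3≤S (runLine (hd (hd (tl (tl arg)))))
          (runThen 3≤S (runSeq (fits u≤) (runLine (hd (tl arg) & hd (tl (tl (tl arg)))))
            (runEqTrue (toℕ i) (toℕ j) (ℕᵇₚ.fromℕ-injective i≡j)))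
            (runElse (runLine (hd arg))
              (runSubtree i false l (hd (tl (tl (tl (tl arg))))) w l≤ u≤ refl)))))
      where open Query i false j l r

    runRestriction : ∀ {k} {ρ : Env k} {n} (i : Fin n) b T →
      Run S ρ restriction (⌜ b ⌝ᵇ ∙ ⌜ toℕ i ⌝ℕ ∙ ⌜ T ⌝ᵗ) ⌜ restrict i b T ⌝ᵗ 2 (∣ ⌜ T ⌝ᵗ ∣ ℕ.* pass)
    runRestriction i b T = runRec (runRestrictBody i b T)

-- Averages over the cube and restrictions

module OrderedField (𝕂 : Scalars) where
  open Scalars 𝕂
  open Theory 𝕂
  open CommutativeRing commutativeRing using
    (+-commutativeSemigroup; *-comm; *-assoc; *-identityˡ; distribˡ)
  open CommutativeSemigroupProperties +-commutativeSemigroup using (interchange)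

  +-cancelʳ-≤ : ∀ {x y} z → x + z ≤ y + z → x ≤ y
  +-cancelʳ-≤ {x} {y} z h = subst₂ _≤_ (drop x) (drop y) (+-monoˡ-≤ (- z) h)
    where
    drop : ∀ w → w + z + - z ≡ w
    drop w = trans (+-assoc w z (- z)) (trans (cong (w +_) (-‿inverseʳ z)) (+-identityʳ w))

  -- If y ≤ x, then x + y ≤ x + x ≤ y + y, and y cancels. This replaces division by two, and so the
  -- identities on averages below are stated in doubled form.
  halve-≤ : ∀ {x y} → x + x ≤ y + y → x ≤ y
  halve-≤ {x} {y} h with total x y
  ... | inj₁ x≤y = x≤y
  ... | inj₂ y≤x = +-cancelʳ-≤ y (≤-trans (+-mono-≤ ≤-refl y≤x) h)

  halve-≡ : ∀ {x y} → x + x ≡ y + y → x ≡ y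
  halve-≡ h = antisym (halve-≤ (≤-reflexive h)) (halve-≤ (≤-reflexive (sym h)))

  fromℕ-+ : ∀ m n → fromℕ (m ℕ.+ n) ≡ fromℕ m + fromℕ n
  fromℕ-+ zero n    = sym (+-identityˡ _)
  fromℕ-+ (suc m) n = trans (cong (1# +_) (fromℕ-+ m n)) (sym (+-assoc 1# (fromℕ m) (fromℕ n)))

  0≤fromℕ : ∀ n → 0# ≤ fromℕ n
  0≤fromℕ zero    = ≤-refl
  0≤fromℕ (suc n) = +-nonNeg 0≤1 (0≤fromℕ n)

  fromℕ≢0 : ∀ n → .{{ℕ.NonZero n}} → fromℕ n ≢ 0#
  fromℕ≢0 (suc n) 1+n≡0 = 0≢1 (antisym 0≤1 (subst₂ _≤_ (+-identityʳ 1#) 1+n≡0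
    (+-mono-≤ (≤-refl {1#}) (0≤fromℕ n))))

  ⁻¹-unique : ∀ {a y} → a ≢ 0# → a * y ≡ 1# → y ≡ a ⁻¹
  ⁻¹-unique {a} {y} a≢0 ay≡1 = begin
    y               ≡⟨ *-identityʳ y ⟨
    y * 1#          ≡⟨ cong (y *_) (⁻¹-inverseʳ a a≢0) ⟨
    y * (a * a ⁻¹)  ≡⟨ *-assoc y a (a ⁻¹) ⟨
    y * a * a ⁻¹    ≡⟨ cong (_* a ⁻¹) (trans (*-comm y a) ay≡1) ⟩
    1# * a ⁻¹       ≡⟨ *-identityˡ (a ⁻¹) ⟩
    a ⁻¹            ∎
    where open ≡-Reasoning

  1/2^-double : ∀ m → fromℕ (2 ^ suc m) ⁻¹ + fromℕ (2 ^ suc m) ⁻¹ ≡ fromℕ (2 ^ m) ⁻¹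
  1/2^-double m = ⁻¹-unique (fromℕ≢0 (2 ^ m) {{ℕₚ.m^n≢0 2 m}}) (begin
    a * (b ⁻¹ + b ⁻¹)      ≡⟨ distribˡ a (b ⁻¹) (b ⁻¹) ⟩
    a * b ⁻¹ + a * b ⁻¹    ≡⟨ distribʳ (b ⁻¹) a a ⟨
    (a + a) * b ⁻¹         ≡⟨ cong (_* b ⁻¹) (fromℕ-+ (2 ^ m) (2 ^ m)) ⟨
    fromℕ (2 ^ m ℕ.+ 2 ^ m) * b ⁻¹
                           ≡⟨ cong (λ k → fromℕ (2 ^ m ℕ.+ k) * b ⁻¹) (ℕₚ.+-identityʳ (2 ^ m)) ⟨
    b * b ⁻¹               ≡⟨ ⁻¹-inverseʳ b (fromℕ≢0 (2 ^ suc m) {{ℕₚ.m^n≢0 2 (suc m)}}) ⟩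
    1#                     ∎)
    where
    open ≡-Reasoning
    a = fromℕ (2 ^ m)
    b = fromℕ (2 ^ suc m)

  ∑-++ : ∀ {A : Set} (f : A → Carrier) as bs → ∑ f (as ++ bs) ≡ ∑ f as + ∑ f bs
  ∑-++ f [] bs       = sym (+-identityˡ _)
  ∑-++ f (a ∷ as) bs = trans (cong (f a +_) (∑-++ f as bs)) (sym (+-assoc (f a) _ _))

  ∑-map : ∀ {A B : Set} (f : B → Carrier) (g : A → B) as → ∑ f (map g as) ≡ ∑ (f ∘ g) as
  ∑-map f g []       = refl
  ∑-map f g (a ∷ as) = cong (f (g a) +_) (∑-map f g as)

  ∑-cong : ∀ {A : Set} {f g : A → Carrier} → f ≗ g → ∀ as → ∑ f as ≡ ∑ g as
  ∑-cong f≗g []       = refl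
  ∑-cong f≗g (a ∷ as) = cong₂ _+_ (f≗g a) (∑-cong f≗g as)

  mean-cong : ∀ n {f g : Vec Bool n → Carrier} → f ≗ g → mean n f ≡ mean n g
  mean-cong n f≗g = cong (_* fromℕ (2 ^ n) ⁻¹) (∑-cong f≗g (cube n))

  mean-double : ∀ n (f : Vec Bool (suc n) → Carrier) →
    mean (suc n) f + mean (suc n) f ≡ mean n (f ∘ (false ∷_)) + mean n (f ∘ (true ∷_))
  mean-double n f = begin
    s * h + s * h       ≡⟨ distribˡ s h h ⟨
    s * (h + h)         ≡⟨ cong (s *_) (1/2^-double n) ⟩
    s * k               ≡⟨ cong (_* k) (∑-++ f (map (false ∷_) (cube n)) _) ⟩
    (∑ f (map (false ∷_) (cube n)) + ∑ f (map (true ∷_) (cube n))) * k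
                        ≡⟨ cong (_* k) (cong₂ _+_ (∑-map f _ (cube n)) (∑-map f _ (cube n))) ⟩
    (∑ (f ∘ (false ∷_)) (cube n) + ∑ (f ∘ (true ∷_)) (cube n)) * k
                        ≡⟨ distribʳ k _ _ ⟩
    mean n (f ∘ (false ∷_)) + mean n (f ∘ (true ∷_)) ∎
    where
    open ≡-Reasoning
    s = ∑ f (cube (suc n))
    h = fromℕ (2 ^ suc n) ⁻¹
    k = fromℕ (2 ^ n) ⁻¹

  mean-const : ∀ n v → mean n (λ _ → v) ≡ v
  mean-const zero v = trans (cong₂ (λ x y → x * y ⁻¹) (+-identityʳ v) (+-identityʳ 1#))
    (trans (cong (v *_) (sym (⁻¹-unique (0≢1 ∘ sym) (*-identityʳ 1#)))) (*-identityʳ v))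
  mean-const (suc n) v =
      halve-≡ (trans (mean-double n (λ _ → v)) (cong₂ _+_ (mean-const n v) (mean-const n v)))

  -- Fixing the first coordinate makes both faces carry the same function, so each mean on the right
  -- is a mean over one face. For a later coordinate both sides are doubled once more, which splits
  -- off the first coordinate, and the induction hypothesis applies on each face.
  mean-fix-coordinate : ∀ {n} (i : Fin n) (g : Vec Bool n → Carrier) →
    mean n g + mean n g ≡ mean n (λ x → g (x [ i ]≔ false)) + mean n (λ x → g (x [ i ]≔ true))
  mean-fix-coordinate {suc n} Fin.zero g = trans (mean-double n g)
    (sym (cong₂ _+_ (fix false) (fix true)))
    where
    fix : ∀ b → mean (suc n) (λ x → g (x [ Fin.zero ]≔ b)) ≡ mean n (g ∘ (b ∷_))
    fix b = halve-≡ (mean-double n (λ x → g (x [ Fin.zero ]≔ b)))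
  mean-fix-coordinate {suc n} (Fin.suc i) g = sym (halve-≡ (begin
    (A false + A true) + (A false + A true)
      ≡⟨ interchange _ _ _ _ ⟩
    (A false + A false) + (A true + A true)
      ≡⟨ cong₂ _+_ (mean-double n _) (mean-double n _) ⟩
    (P false false + P true false) + (P false true + P true true)
      ≡⟨ interchange _ _ _ _ ⟩
    (P false false + P false true) + (P true false + P true true)
      ≡⟨ cong₂ _+_ (mean-fix-coordinate i (g ∘ (false ∷_)))
          (mean-fix-coordinate i (g ∘ (true ∷_))) ⟨
    (M false + M false) + (M true + M true)
      ≡⟨ interchange _ _ _ _ ⟩
    (M false + M true) + (M false + M true)
      ≡⟨ cong₂ _+_ (mean-double n g) (mean-double n g) ⟨
    (G + G) + (G + G) ∎))
    where
    open ≡-Reasoning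
    G = mean (suc n) g
    A M : Bool → Carrier
    A b = mean (suc n) (λ x → g (x [ Fin.suc i ]≔ b))
    M c = mean n (g ∘ (c ∷_))
    P : Bool → Bool → Carrier
    P c b = mean n (λ x → g (c ∷ (x [ i ]≔ b)))

-- Restricted trees and the structure of optimal trees

module Restriction (𝕂 : Scalars) where
  open Scalars 𝕂
  open Theory 𝕂
  open OrderedField 𝕂
  open Machine 𝕂 using (restrict; 1≤∣_∣; ∙-mono; ∣u∣≤∣u∙v∣; ∣v∣≤∣u∙v∣)

  [0,1]-≡ : ∀ {a b : [0,1]} → value a ≡ value b → a ≡ b
  [0,1]-≡ refl = refl

  randomness-restrict : ∀ {n} (i : Fin n) b T → randomness (restrict i b T) ℕ.≤ randomness T
  randomness-restrict i b (leaf v) = ℕ.z≤n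
  randomness-restrict i b (random l r) =
    ℕ.s≤s (ℕₚ.⊔-mono-≤ (randomness-restrict i b l) (randomness-restrict i b r))
  randomness-restrict i b (query j l r) with ℕᵇ.fromℕ (toℕ i) ℕᵇₚ.≟ ℕᵇ.fromℕ (toℕ j)
  randomness-restrict i b (query j l r) | no _ =
    ℕₚ.⊔-mono-≤ (randomness-restrict i b l) (randomness-restrict i b r)
  randomness-restrict i false (query j l r) | yes _ = ℕₚ.m≤n⇒m≤n⊔o _ (randomness-restrict i false l)
  randomness-restrict i true (query j l r) | yes _ = ℕₚ.m≤n⇒m≤o⊔n _ (randomness-restrict i true r)

  queries-restrict : ∀ {n} (i : Fin n) b T → queries (restrict i b T) ℕ.≤ queries T
  queries-restrict i b (leaf v) = ℕ.z≤n
  queries-restrict i b (random l r) =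
    ℕₚ.⊔-mono-≤ (queries-restrict i b l) (queries-restrict i b r)
  queries-restrict i b (query j l r) with ℕᵇ.fromℕ (toℕ i) ℕᵇₚ.≟ ℕᵇ.fromℕ (toℕ j)
  queries-restrict i b (query j l r) | no _ =
    ℕ.s≤s (ℕₚ.⊔-mono-≤ (queries-restrict i b l) (queries-restrict i b r))
  queries-restrict i false (query j l r) | yes _ =
      ℕₚ.m≤n⇒m≤1+n (ℕₚ.m≤n⇒m≤n⊔o _ (queries-restrict i false l))
  queries-restrict i true (query j l r) | yes _ =
      ℕₚ.m≤n⇒m≤1+n (ℕₚ.m≤n⇒m≤o⊔n _ (queries-restrict i true r))

  ∣restrict∣≤ : ∀ {n} (i : Fin n) b T → ∣ ⌜ restrict i b T ⌝ᵗ ∣ ℕ.≤ ∣ ⌜ T ⌝ᵗ ∣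
  ∣restrict∣≤ i b (leaf v) = ℕₚ.≤-refl
  ∣restrict∣≤ i b (random l r) = ∙-mono ⌜ 2 ⌝ℕ (⌜ restrict i b l ⌝ᵗ ∙ ⌜ restrict i b r ⌝ᵗ) ℕₚ.≤-refl
    (∙-mono ⌜ restrict i b l ⌝ᵗ ⌜ restrict i b r ⌝ᵗ (∣restrict∣≤ i b l) (∣restrict∣≤ i b r))
  ∣restrict∣≤ i b (query j l r) with ℕᵇ.fromℕ (toℕ i) ℕᵇₚ.≟ ℕᵇ.fromℕ (toℕ j)
  ∣restrict∣≤ i b (query j l r) | no _ =
    ∙-mono ⌜ 1 ⌝ℕ (⌜ toℕ j ⌝ℕ ∙ ⌜ restrict i b l ⌝ᵗ ∙ ⌜ restrict i b r ⌝ᵗ) ℕₚ.≤-refl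
      (∙-mono ⌜ toℕ j ⌝ℕ (⌜ restrict i b l ⌝ᵗ ∙ ⌜ restrict i b r ⌝ᵗ) ℕₚ.≤-refl
        (∙-mono ⌜ restrict i b l ⌝ᵗ ⌜ restrict i b r ⌝ᵗ (∣restrict∣≤ i b l) (∣restrict∣≤ i b r)))
  ∣restrict∣≤ i false (query j l r) | yes _ = ℕₚ.≤-trans (∣restrict∣≤ i false l)
    (ℕₚ.≤-trans (∣u∣≤∣u∙v∣ ⌜ l ⌝ᵗ ⌜ r ⌝ᵗ)
      (ℕₚ.≤-trans (∣v∣≤∣u∙v∣ ⌜ toℕ j ⌝ℕ (⌜ l ⌝ᵗ ∙ ⌜ r ⌝ᵗ))
        (∣v∣≤∣u∙v∣ ⌜ 1 ⌝ℕ (⌜ toℕ j ⌝ℕ ∙ ⌜ l ⌝ᵗ ∙ ⌜ r ⌝ᵗ))))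
  ∣restrict∣≤ i true (query j l r) | yes _ = ℕₚ.≤-trans (∣restrict∣≤ i true r)
    (ℕₚ.≤-trans (∣v∣≤∣u∙v∣ ⌜ l ⌝ᵗ ⌜ r ⌝ᵗ)
      (ℕₚ.≤-trans (∣v∣≤∣u∙v∣ ⌜ toℕ j ⌝ℕ (⌜ l ⌝ᵗ ∙ ⌜ r ⌝ᵗ))
        (∣v∣≤∣u∙v∣ ⌜ 1 ⌝ℕ (⌜ toℕ j ⌝ℕ ∙ ⌜ l ⌝ᵗ ∙ ⌜ r ⌝ᵗ))))

  fromℕ∘toℕ-injective : ∀ {n} {i j : Fin n} → ℕᵇ.fromℕ (toℕ i) ≡ ℕᵇ.fromℕ (toℕ j) → i ≡ j
  fromℕ∘toℕ-injective = Finₚ.toℕ-injective ∘ ℕᵇₚ.fromℕ-injective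

  -- Restriction can lower the randomness, so the two sides average over random strings of different
  -- lengths. The induction therefore allows all sufficient lengths: a random node consumes one bit
  -- on either side, and at a leaf the unread bits average out.
  mean-run-restrict : ∀ {n}
      (i : Fin n) b T x {m m′} .(h : randomness T ℕ.≤ m) .(h′ : randomness
        (restrict i b T) ℕ.≤ m′) →
    mean m′ (λ r → value (run (restrict i b T) h′ x r)) ≡ mean m
        (λ r → value (run T h (x [ i ]≔ b) r))
  mean-run-restrict i b (leaf v) x {m} {m′} h h′ =
      trans (mean-const m′ (value v)) (sym (mean-const m (value v)))
  mean-run-restrict i b (random l r) x {suc m} {suc m′} h h′ = halve-≡ (trans
    (mean-double m′ (λ s → value (run (restrict i b (random l r)) h′ x s)))
    (trans (cong₂ _+_
        (mean-run-restrict i b l x (ℕₚ.m⊔n≤o⇒m≤o _ (randomness r) (ℕ.s≤s⁻¹ h))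
          (ℕₚ.m⊔n≤o⇒m≤o _ (randomness (restrict i b r)) (ℕ.s≤s⁻¹ h′)))
        (mean-run-restrict i b r x (ℕₚ.m⊔n≤o⇒n≤o (randomness l) _ (ℕ.s≤s⁻¹ h))
          (ℕₚ.m⊔n≤o⇒n≤o (randomness (restrict i b l)) _ (ℕ.s≤s⁻¹ h′))))
      (sym (mean-double m (λ s → value (run (random l r) h (x [ i ]≔ b) s))))))
  mean-run-restrict i b (query j l r) x h h′ with ℕᵇ.fromℕ (toℕ i) ℕᵇₚ.≟ ℕᵇ.fromℕ (toℕ j)
  mean-run-restrict i b (query j l r) x h h′ | no i≢j
    rewrite Vecₚ.lookup∘updateAt′ j i {λ _ → b}
        (λ j≡i → i≢j (cong (ℕᵇ.fromℕ ∘ toℕ) (sym j≡i))) x with lookup x j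
  ... | false =
      mean-run-restrict i b l x (ℕₚ.m⊔n≤o⇒m≤o _ (randomness r) h)
          (ℕₚ.m⊔n≤o⇒m≤o _ (randomness (restrict i b r)) h′)
  ... | true = mean-run-restrict i b r x (ℕₚ.m⊔n≤o⇒n≤o (randomness l) _ h)
      (ℕₚ.m⊔n≤o⇒n≤o (randomness (restrict i b l)) _ h′)
  mean-run-restrict i b (query j l r) x h h′ | yes i≡j
    with refl ← fromℕ∘toℕ-injective {i = i} {j} i≡j rewrite Vecₚ.lookup∘updateAt i {λ _ →
        b} x with b
  ... | false = mean-run-restrict i false l x (ℕₚ.m⊔n≤o⇒m≤o _ (randomness r) h) h′
  ... | true = mean-run-restrict i true r x (ℕₚ.m⊔n≤o⇒n≤o (randomness l) _ h) h′

  μ-restrict : ∀ {n} (i : Fin n) b R x → μ (restrict i b R) x ≡ μ R (x [ i ]≔ b)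
  μ-restrict i b R x = [0,1]-≡ (mean-run-restrict i b R x ℕₚ.≤-refl ℕₚ.≤-refl)

  queryᴰ : ∀ {n} → Fin n → DDT n → DDT n → DDT n
  queryᴰ i (mk l l-det) (mk r r-det) = mk (query i l r) (cong₂ _⊔_ l-det r-det)

  restrictᴰ : ∀ {n} → Fin n → Bool → DDT n → DDT n
  restrictᴰ i b (mk T det) = mk (restrict i b T)
    (ℕₚ.n≤0⇒n≡0 (ℕₚ.≤-trans (randomness-restrict i b T) (ℕₚ.≤-reflexive det)))

  evaluate-queryᴰ : ∀ {n} (i : Fin n) (D₀ D₁ : DDT n) x →
    evaluate (queryᴰ i D₀ D₁) x ≡ (if lookup x i then evaluate D₁ x else evaluate D₀ x)
  evaluate-queryᴰ i (mk _ _) (mk _ _) x = refl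

  -- A deterministic run is its own mean over the cube of dimension 0, which turns this into a case
  -- of the randomized statement.
  evaluate-restrictᴰ : ∀ {n} (i : Fin n) b D x →
      evaluate (restrictᴰ i b D) x ≡ evaluate D (x [ i ]≔ b)
  evaluate-restrictᴰ i b (mk T det) x = [0,1]-≡ (trans (sym (mean-const 0 _))
    (trans (mean-run-restrict i b T x (ℕₚ.≤-reflexive det)
        (ℕₚ.≤-trans (randomness-restrict i b T) (ℕₚ.≤-reflexive det)))
      (mean-const 0 _)))

  data Shape {n} : DDT n → Set where
    isConstant : ∀ c → Shape (constant c)
    isQuery    : ∀ i D₀ D₁ → Shape (queryᴰ i D₀ D₁)

  shape : ∀ {n} (D : DDT n) → Shape D
  shape (mk (leaf v) _)      = isConstant v
  shape (mk (query i l r) det) = isQuery i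
    (mk l (ℕₚ.n≤0⇒n≡0 (ℕₚ.m⊔n≤o⇒m≤o _ (randomness r) (ℕₚ.≤-reflexive det))))
    (mk r (ℕₚ.n≤0⇒n≡0 (ℕₚ.m⊔n≤o⇒n≤o (randomness l) _ (ℕₚ.≤-reflexive det))))
  shape (mk (random l r) ())

  module Optimality (ℰ : ErrorMetric) (natural : Natural ℰ) where

    Err : ∀ {n} → RDT n → DDT n → Carrier
    Err R D = value (ℰ R D)

    d : [0,1] → [0,1] → [0,1]
    d = proj₁ natural

    Err≡mean : ∀ {n} (R : RDT n) D → Err R D ≡ mean n (λ x → value (d (μ R x) (evaluate D x)))
    Err≡mean R D = cong value (proj₂ natural R D)

    -- Naturality enters here: the metric sees only the mean function of `R` and the function
    -- computed by `D`, not their trees.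
    Err-cong : ∀ {n} {R R′ : RDT n} {D D′} → μ R ≗ μ R′ → evaluate D ≗ evaluate D′ →
        Err R D ≡ Err R′ D′
    Err-cong {n} {R} {R′} {D} {D′} R≗R′ D≗D′ = trans (Err≡mean R D)
      (trans (mean-cong n (λ x → cong₂ (λ u v → value (d u v)) (R≗R′ x) (D≗D′ x)))
        (sym (Err≡mean R′ D′)))

    Err-split : ∀ {n} (i : Fin n) R D → Err R D + Err R D ≡
      Err (restrict i false R) (restrictᴰ i false D) + Err (restrict i true R) (restrictᴰ i true D)
    Err-split {n} i R D = trans (cong₂ _+_ (Err≡mean R D) (Err≡mean R D))
      (trans (mean-fix-coordinate i _) (cong₂ _+_ (half false) (half true)))
      where
      half : ∀ b → mean n (λ x → value (d (μ R (x [ i ]≔ b)) (evaluate D (x [ i ]≔ b)))) ≡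
                   Err (restrict i b R) (restrictᴰ i b D)
      half b = trans (mean-cong n (λ x → cong₂ (λ u v → value (d u v))
          (sym (μ-restrict i b R x)) (sym (evaluate-restrictᴰ i b D x))))
        (sym (Err≡mean (restrict i b R) (restrictᴰ i b D)))

    -- Once x_i is overwritten by b, the root query always takes branch b. The branches may query
    -- x_i again, which is why they appear restricted on the right.
    Err-queryᴰ : ∀ {n} (i : Fin n) R D₀ D₁ → Err R (queryᴰ i D₀ D₁) + Err R (queryᴰ i D₀ D₁) ≡
      Err (restrict i false R) (restrictᴰ i false D₀) + Err (restrict i true R)
          (restrictᴰ i true D₁)
    Err-queryᴰ i R D₀ D₁ = trans (Err-split i R (queryᴰ i D₀ D₁))
      (cong₂ _+_ (Err-cong (λ _ → refl) (branch false)) (Err-cong (λ _ → refl) (branch true)))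
      where
      branch : ∀ b x →
          evaluate (restrictᴰ i b (queryᴰ i D₀ D₁)) x ≡ evaluate
              (restrictᴰ i b (if b then D₁ else D₀)) x
      branch b x = trans (evaluate-restrictᴰ i b (queryᴰ i D₀ D₁) x)
        (trans (evaluate-queryᴰ i D₀ D₁ (x [ i ]≔ b))
          (trans (cong (if_then evaluate D₁ (x [ i ]≔ b) else evaluate D₀ (x [ i ]≔ b))
            (Vecₚ.lookup∘updateAt i x))
            (trans (pick b) (sym (evaluate-restrictᴰ i b (if b then D₁ else D₀) x)))))
        where
        pick : ∀ c → (if c then evaluate D₁ (x [ i ]≔ b) else evaluate D₀ (x [ i ]≔ b)) ≡
                     evaluate (if c then D₁ else D₀) (x [ i ]≔ b)
        pick false = refl
        pick true  = refl

    Optimal : ∀ {n} → ℕ → RDT n → DDT n → Set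
    Optimal k R D = queries (tree D) ℕ.≤ k × (∀ D′ → queries (tree D′) ℕ.≤ k → Err R D ≤ Err R D′)

    queries-restrictᴰ : ∀ {n k} (i : Fin n) b D → queries (tree D) ℕ.≤ k →
        queries (tree (restrictᴰ i b D)) ℕ.≤ k
    queries-restrictᴰ i b (mk T _) = ℕₚ.≤-trans (queries-restrict i b T)

    μ-restrict-twice : ∀ {n} (i : Fin n) b c R →
        μ (restrict i c (restrict i b R)) ≗ μ (restrict i b R)
    μ-restrict-twice i b c R x = trans (μ-restrict i c (restrict i b R) x)
      (trans (μ-restrict i b R (x [ i ]≔ c))
        (trans (cong (μ R) (Vecₚ.[]≔-idempotent x i)) (sym (μ-restrict i b R x))))

    -- F may query i, but its two restrictions have average error Err F and
    -- neither beats it, so both are as good as F.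
    restrict-optimal : ∀ {n k} (i : Fin n) b R F → Optimal k (restrict i b R) F →
      Err (restrict i b R) (restrictᴰ i b F) ≤ Err (restrict i b R) F
    restrict-optimal {n} {k} i b R F (F≤k , best) = bound b
      where
      R′ = restrict i b R
      e : Bool → Carrier
      e c = Err R′ (restrictᴰ i c F)
      F≤ : ∀ c → Err R′ F ≤ e c
      F≤ c = best (restrictᴰ i c F) (queries-restrictᴰ i c F F≤k)
      average : e false + e true ≤ Err R′ F + Err R′ F
      average = ≤-reflexive (sym (trans (Err-split i R′ F)
        (cong₂ _+_ (Err-cong (μ-restrict-twice i b false R) (λ _ → refl))
                   (Err-cong (μ-restrict-twice i b true R) (λ _ → refl)))))
      bound : ∀ c → e c ≤ Err R′ F
      bound false = +-cancelʳ-≤ (Err R′ F) (≤-trans (+-mono-≤ ≤-refl (F≤ true)) average)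
      bound true  = +-cancelʳ-≤ (Err R′ F) (≤-trans (+-mono-≤ ≤-refl (F≤ false))
        (subst (_≤ Err R′ F + Err R′ F) (+-comm (e false) (e true)) average))

    -- Doubled errors split over the two restrictions of `R`. There `restrict-optimal` passes from
    -- the restriction of a chosen tree to that tree, which is then compared with the restriction of
    -- its competitor, still a tree of at most `k` queries.
    query-optimal : ∀ {n k} (i : Fin n) R F₀ F₁ →
      Optimal k (restrict i false R) F₀ → Optimal k (restrict i true R) F₁ →
      ∀ D₀ D₁ → queries (tree D₀) ℕ.≤ k → queries (tree D₁) ℕ.≤ k →
      Err R (queryᴰ i F₀ F₁) ≤ Err R (queryᴰ i D₀ D₁)
    query-optimal {k = k} i R F₀ F₁ opt₀ opt₁ D₀ D₁ D₀≤k D₁≤k = halve-≤ (subst₂ _≤_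
      (sym (Err-queryᴰ i R F₀ F₁)) (sym (Err-queryᴰ i R D₀ D₁))
      (+-mono-≤ (beats false F₀ opt₀ D₀ D₀≤k) (beats true F₁ opt₁ D₁ D₁≤k)))
      where
      beats : ∀ b F → Optimal k (restrict i b R) F → ∀ D → queries (tree D) ℕ.≤ k →
        Err (restrict i b R) (restrictᴰ i b F) ≤ Err (restrict i b R) (restrictᴰ i b D)
      beats b F opt D D≤k = ≤-trans (restrict-optimal i b R F opt)
        (proj₂ opt (restrictᴰ i b D) (queries-restrictᴰ i b D D≤k))

-- The search

module Search (𝕂 : Scalars) (A-err A-min : Theory.Algorithm 𝕂) where
  open Scalars 𝕂
  open Theory 𝕂
  open Machine 𝕂
  open Restriction 𝕂

  -- The search handles candidates as bare tree codes. The number of variables that completes a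
  -- description is copied from `R`.
  errorOf : Line → Line → Prog 1
  errorOf R D = ⌊ R & hd R & D ⌋ ⨾ ↑ A-err

  -- The components of a call: the depth in unary, all variables, those still
  -- to be tried at the root, and the tree to approximate.
  dˡ Lˡ Mˡ Rˡ : Line
  dˡ = hd arg
  Lˡ = hd (tl arg)
  Mˡ = hd (tl (tl arg))
  Rˡ = tl (tl (tl arg))

  -- The root variable is chosen by recursion on the list: `skipRoot` drops its first entry at the
  -- same depth, while `subtree` lowers the depth and resets the list. An exhausted list yields the
  -- best constant, so every query tree has a competitor. The `nil` in `minimizerLeaf` is the tag 0
  -- of a leaf.
  minimizerLeaf skipRoot candidates choose findBody : Prog 1
  subtree : Bool → Prog 1
  minimizerLeaf = ⟨ ⌊ lit nil ⌋ , ⌊ Rˡ ⌋ ⨾ ↑ A-min ⟩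
  skipRoot = ⌊ dˡ & Lˡ & tl Mˡ & Rˡ ⌋ ⨾ self
  subtree b = ⟨ ⌊ tl dˡ ⌋ , ⟨ ⌊ Lˡ ⌋ , ⟨ ⌊ Lˡ ⌋ , ⟨ ⌊ hd Rˡ ⌋ ,
    ⌊ lit ⌜ b ⌝ᵇ & hd Mˡ & tl Rˡ ⌋ ⨾ restriction ⟩ ⟩ ⟩ ⟩ ⨾ self
  candidates = ⟨ ⌊ Rˡ ⌋ , ⟨ skipRoot ,
    ⟨ ⌊ lit ⌜ 1 ⌝ℕ ⌋ , ⟨ ⌊ hd Mˡ ⌋ , ⟨ subtree false , subtree true ⟩ ⟩ ⟩ ⟩ ⟩
  choose = ifte
      (⟨ errorOf (hd arg) (hd (tl arg)) , errorOf (hd arg) (tl (tl arg)) ⟩ ⨾ ⌊ arg ▷ leq ⌋)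
    ⌊ hd (tl arg) ⌋ ⌊ tl (tl arg) ⌋
  findBody = ifte ⌊ dˡ ▷ pair? ⌋
    (ifte ⌊ Mˡ ▷ pair? ⌋ (candidates ⨾ choose) minimizerLeaf) minimizerLeaf

  find : Prog 0
  find = rec findBody

  -- They read the loop state and the code of `R` after the search has paired the state with the
  -- tree found.
  sˡ Iˡ : Line
  sˡ = hd arg
  Iˡ = hd (tl (tl sˡ))

  loopBody : Prog 1
  loopBody = ⟨ ⌊ arg ⌋ , ⌊ hd arg & hd (tl arg) & hd (tl arg) & hd (tl (tl arg)) ⌋ ⨾ ↑ find ⟩ ⨾
    ifte (⟨ errorOf Iˡ (tl arg) , ⌊ tl (tl (tl sˡ)) ⌋ ⟩ ⨾ ⌊ arg ▷ leq ⌋)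
      ⌊ hd Iˡ & tl arg ⌋
      (⟨ ⌊ lit nil & hd sˡ ⌋ , ⟨ ⌊ lit nil & hd Iˡ ⌋ ⨾ range , ⌊ tl (tl sˡ) ⌋ ⟩ ⟩ ⨾ self)

  instanceOpt : Algorithm
  instanceOpt = ⌊ lit nil & lit nil & arg ⌋ ⨾ rec loopBody

  -- The variables are B, Pe, Pm, Q and ν of the correctness proof below.
  costPoly : Poly 5
  costPoly = (S ⊗ con unit) ⊕ (Q ⊗ round)
    where
    B Pe Pm Q ν S pass′ P round : Poly 5
    B = var 0F
    Pe = var 1F
    Pm = var 2F
    Q = var 3F
    ν = var 4F
    S = B ⊗ con 40
    pass′ = (S ⊗ con unit) ⊕ ((S ⊗ (S ⊗ con unit)) ⊕ (S ⊗ (S ⊗ con unit)))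
    P = ((S ⊗ con unit) ⊕ (((B ⊗ pass′) ⊕ (B ⊗ pass′)) ⊕ (Pe ⊕ Pe))) ⊕ Pm
    round = (S ⊗ con unit) ⊕ (((P ⊗ Q) ⊕ Pe) ⊕ ((con 1 ⊕ ν) ⊗ pass′))

  ⌜_⌝ᵘ : ℕ → Val
  ⌜ zero ⌝ᵘ  = nil
  ⌜ suc d ⌝ᵘ = nil ∙ ⌜ d ⌝ᵘ

  -- N bounds the code of the randomized tree, W that of a list of variables, Dmax
  -- that of a candidate tree, Pm and Pe the times of the two oracles, and B all
  -- values of which the intermediate results are tuples.
  module Correctness (ℰ : ErrorMetric) (natural : Natural ℰ)
    {n q N W Pm Pe Dmax B : ℕ}
    (3≤B : 3 ℕ.≤ B) (N≤B : N ℕ.≤ B) (W≤B : W ℕ.≤ B) (Dmax≤B : Dmax ℕ.≤ B) (Pe≤B : Pe ℕ.≤ B)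
    (minimizer : ∀ (R : RDT n) → queries R ℕ.≤ q → ∣ ⌜ R ⌝ ∣ ℕ.≤ N →
      ∃[ c ] c IsConstantMinimizerOf ℰ for R × A-min on ⌜ R ⌝ returns scalar (value c) within Pm)
    (error : ∀ (R : RDT n) D → queries R ℕ.≤ q → ∣ ⌜ R ⌝ ∣ ℕ.≤ N → ∣ ⌜ tree D ⌝ ∣ ℕ.≤ Dmax →
      A-err on (⌜ R ⌝ ∙ ⌜ tree D ⌝) returns scalar (value (ℰ R D)) within Pe)
    where
    open Optimality ℰ natural

    -- All values handled are tuples of a few components of size at most `B`. The factor 40
    -- generously covers the components and the pair cells joining them.
    S : ℕ
    S = B ℕ.* 40

    -- As a record it lets `v` and `k` be inferred from a proof, so that `fit` can check the bound
    -- on `k` by evaluation.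
    record _≲_ (v : Val) (k : ℕ) : Set where
      constructor bounded-by
      field size-bound : ∣ v ∣ ℕ.≤ B ℕ.* k

    open _≲_

    1≤B : 1 ℕ.≤ B
    1≤B = ℕₚ.≤-trans (ℕ.s≤s ℕ.z≤n) 3≤B

    atom : ∀ v → ∣ v ∣ ℕ.≤ B → v ≲ 1
    atom v v≤ .size-bound = ℕₚ.≤-trans v≤ (ℕₚ.≤-reflexive (sym (ℕₚ.*-identityʳ B)))

    _∙≲_ : ∀ {u v a b} → u ≲ a → v ≲ b → (u ∙ v) ≲ suc (a ℕ.+ b)
    _∙≲_ {u} {v} {a} {b} (bounded-by u≲) (bounded-by v≲) .size-bound =
        ℕₚ.≤-trans (ℕₚ.+-mono-≤ 1≤B (ℕₚ.+-mono-≤ u≲ v≲))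
      (ℕₚ.≤-reflexive
        (solve 3 (λ x y z → x :+ (x :* y :+ x :* z) := x :* (con 1 :+ (y :+ z))) refl B a b))
      where open +-*-Solver
    infixr 5 _∙≲_

    fit : ∀ v {k} {_ : T (k ℕ.≤ᵇ 40)} → v ≲ k → ∣ v ∣ ℕ.≤ S
    fit v {k} {k≤} (bounded-by v≲) = ℕₚ.≤-trans v≲ (ℕₚ.*-monoʳ-≤ B (ℕₚ.≤ᵇ⇒≤ k 40 k≤))

    3≤S : 3 ℕ.≤ S
    3≤S = fit ⌜ true ⌝ᵇ (atom ⌜ true ⌝ᵇ 3≤B)

    -- Covers one node without its subtrees: 8 for the coding of a query plus an index of size at
    -- most `W`, or a leaf whose scalar was written by the minimizer in time `Pm`.
    V : ℕ
    V = 8 ℕ.+ W ℕ.+ Pm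

    treeSize : ℕ → ℕ
    treeSize zero    = V
    treeSize (suc d) = V ℕ.+ (treeSize d ℕ.+ treeSize d)

    treeSize-suc : ∀ d → treeSize d ℕ.≤ treeSize (suc d)
    treeSize-suc d = ℕₚ.≤-trans (ℕₚ.m≤m+n _ (treeSize d)) (ℕₚ.m≤n+m _ V)

    V≤treeSize : ∀ d → V ℕ.≤ treeSize d
    V≤treeSize zero    = ℕₚ.≤-refl
    V≤treeSize (suc d) = ℕₚ.m≤m+n V _

    -- The cost of one call of `find` apart from its recursive calls: overhead, two restrictions and
    -- two errors at a query, `Pm` at a leaf.
    P : ℕ
    P = S ℕ.* unit ℕ.+ ((B ℕ.* pass 3≤S ℕ.+ B ℕ.* pass 3≤S) ℕ.+ (Pe ℕ.+ Pe)) ℕ.+ Pm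

    treeSize-mono : ∀ {d e} → d ℕ.≤ e → treeSize d ℕ.≤ treeSize e
    treeSize-mono {e = e} ℕ.z≤n     = V≤treeSize e
    treeSize-mono (ℕ.s≤s d≤e) = ℕₚ.+-monoʳ-≤ V (ℕₚ.+-mono-≤ (treeSize-mono d≤e) (treeSize-mono d≤e))

    -- Adding `V` turns the recurrence into plain doubling.
    treeSize-bound : ∀ d → treeSize d ℕ.+ V ℕ.≤ 2 ^ d ℕ.* (2 ℕ.* V)
    treeSize-bound zero    = ℕₚ.≤-reflexive (solve 1 (λ v → v :+ v := con 1 :* (con 2 :* v)) refl V)
      where open +-*-Solver
    treeSize-bound (suc d) = begin
      V ℕ.+ (treeSize d ℕ.+ treeSize d) ℕ.+ V
        ≡⟨ solve 2 (λ v t → v :+ (t :+ t) :+ v := (t :+ v) :+ (t :+ v)) refl V (treeSize d) ⟩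
      (treeSize d ℕ.+ V) ℕ.+ (treeSize d ℕ.+ V)
        ≤⟨ ℕₚ.+-mono-≤ (treeSize-bound d) (treeSize-bound d) ⟩
      2 ^ d ℕ.* (2 ℕ.* V) ℕ.+ 2 ^ d ℕ.* (2 ℕ.* V)
        ≡⟨ solve 2 (λ p v → p :* v :+ p :* v := (con 2 :* p) :* v) refl (2 ^ d) (2 ℕ.* V) ⟩
      2 ^ suc d ℕ.* (2 ℕ.* V) ∎
      where
      open ℕₚ.≤-Reasoning
      open +-*-Solver

    module Level (L : List (Fin n)) (L≤W : ∣ ⌜ L ⌝ˡ ∣ ℕ.≤ W) where

      time : ℕ → ℕ → ℕ
      time zero    m       = P
      time (suc d) zero    = P
      time (suc d) (suc m) = P ℕ.+ (time (suc d) m ℕ.+ (time d (length L) ℕ.+ time d (length L)))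

      state : ∀ (d : ℕ) (M : List (Fin n)) (R : RDT n) → Val
      state d M R = ⌜ d ⌝ᵘ ∙ ⌜ L ⌝ˡ ∙ ⌜ M ⌝ˡ ∙ ⌜ R ⌝

      -- The tree, its optimality among roots in `M` and its computation are built together, because
      -- the branch taken by the program depends on the errors of the trees found.
      record Found (d : ℕ) (M : List (Fin n)) (R : RDT n) : Set where
        field
          result      : DDT n
          result≤d    : queries (tree result) ℕ.≤ d
          size≤       : ∣ ⌜ tree result ⌝ᵗ ∣ ℕ.≤ treeSize d
          ≤constant   : ∀ c → Err R result ≤ Err R (constant c)
          ≤query      : ∀ {i} → i ∈ M → ∀ D₀ D₁ →
              suc (queries (tree D₀) ⊔ queries (tree D₁)) ℕ.≤ d →
                        Err R result ≤ Err R (queryᴰ i D₀ D₁)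
          computed    : Run S ([] ▹ findBody) findBody (state d M R) ⌜ tree result ⌝ᵗ 0
              (time d (length M))
      open Found public

      -- At depth 0 only constants compete, so completeness of `L` is asked for positive depth
      -- alone. This admits the empty list of the first round.
      optimal : ∀ {d R} → (1 ℕ.≤ d → ∀ i → i ∈ L) → (D : Found d L R) → Optimal d R (result D)
      optimal {d} {R} complete D = result≤d D , λ D′ → by-shape D′ (shape D′)
        where
        by-shape : ∀ D′ → Shape D′ → queries (tree D′) ℕ.≤ d → Err R (result D) ≤ Err R D′
        by-shape _ (isConstant c) _ = ≤constant D c
        by-shape _ (isQuery i D₀ D₁) h = ≤query D (complete (ℕₚ.≤-trans (ℕ.s≤s ℕ.z≤n) h) i) D₀ D₁ h

      leafOverhead : ℕ
      leafOverhead = 2 ℕ.+ (weight (lit nil) ℕ.+ (2 ℕ.+ (weight Rˡ ℕ.+ 2)))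

      S+Pm≤P : S ℕ.* unit ℕ.+ Pm ℕ.≤ P
      S+Pm≤P = ℕₚ.+-monoˡ-≤ Pm (ℕₚ.m≤m+n (S ℕ.* unit) _)

      -- Serves depth 0 and the exhausted list alike. They differ in the tests that lead to
      -- `minimizerLeaf`, supplied by `runs`, and in why no query tree competes.
      leafFound : ∀ d M R → queries R ℕ.≤ q → ∣ ⌜ R ⌝ ∣ ℕ.≤ N →
        (∀ {i} → i ∈ M → ∀ (D₀ D₁ : DDT n) → ¬ suc (queries (tree D₀) ⊔ queries (tree D₁)) ℕ.≤ d) →
        (∀ {w} →
          Run S ([] ▹ findBody) minimizerLeaf (state d M R) w leafOverhead Pm →
          Run S ([] ▹ findBody) findBody (state d M R) w 0 (time d (length M))) →
        Found d M R
      leafFound d M R R≤q R≤N noQuery runs with minimizer R R≤q R≤N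
      ... | c , c-min , A@(_ , d⇓ , c≤Pm) = record
        { result    = constant c
        ; result≤d  = ℕ.z≤n
        ; size≤     =
            ℕₚ.≤-trans (ℕₚ.+-mono-≤ {2} {8 ℕ.+ W} (ℕ.s≤s (ℕ.s≤s ℕ.z≤n))
                (ℕₚ.≤-trans (output≤cost d⇓) c≤Pm))
                        (V≤treeSize d)
        ; ≤constant = c-min
        ; ≤query    = λ i∈M D₀ D₁ h → ⊥-elim (noQuery i∈M D₀ D₁ h)
        ; computed  = runs (runFork (runLine (lit nil))
            (runSeq (fit ⌜ R ⌝ (atom ⌜ R ⌝ (ℕₚ.≤-trans R≤N N≤B))) (runLine (tl (tl (tl arg))))
              (run↑ (runAlgorithm A))))
        }

      runErrorOf : ∀ Rˡ Dˡ u R D → queries R ℕ.≤ q → ∣ ⌜ R ⌝ ∣ ℕ.≤ N → ∣ ⌜ tree D ⌝ ∣ ℕ.≤ Dmax →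
        eval Rˡ u ≡ ⌜ R ⌝ → eval Dˡ u ≡ ⌜ tree D ⌝ᵗ → ∀ {r} →
        Run S ([] ▹ r) (errorOf Rˡ Dˡ) u (scalar (Err R D))
            (2 ℕ.+ (weight (Rˡ & hd Rˡ & Dˡ) ℕ.+ 2)) Pe
      runErrorOf Rˡ Dˡ u R D R≤q R≤N D≤Dmax R≡ D≡ {r} = runSeq
        (fit (⌜ R ⌝ ∙ ⌜ tree D ⌝)
          (atom ⌜ R ⌝ (ℕₚ.≤-trans R≤N N≤B) ∙≲ atom ⌜ tree D ⌝ (ℕₚ.≤-trans D≤Dmax Dmax≤B)))
        (subst₂ (λ v w →
          Run S ([] ▹ r) ⌊ Rˡ & hd Rˡ & Dˡ ⌋ u (v ∙ apply fst v ∙ w) (weight (Rˡ & hd Rˡ & Dˡ)) 0)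
          R≡ D≡ (runLine (Rˡ & hd Rˡ & Dˡ)))
        (run↑ (runAlgorithm (error R D R≤q R≤N D≤Dmax)))

      runLeqTrue : ∀ {k} {ρ : Env k} {a b} → a ≤ b →
          Run S ρ ⌊ arg ▷ leq ⌋ (scalar a ∙ scalar b) ⌜ true ⌝ᵇ (weight (arg ▷ leq)) 0
      runLeqTrue {ρ = ρ} {a} {b} a≤b =
          subst (λ c → Run S ρ ⌊ arg ▷ leq ⌋ (scalar a ∙ scalar b) ⌜ c ⌝ᵇ (weight (arg ▷ leq)) 0)
        (dec-true (a ≤? b) a≤b) (runLine (arg ▷ leq))

      runLeqFalse : ∀ {k} {ρ : Env k} {a b} → ¬ a ≤ b →
          Run S ρ ⌊ arg ▷ leq ⌋ (scalar a ∙ scalar b) nil (weight (arg ▷ leq)) 0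
      runLeqFalse {ρ = ρ} {a} {b} a≰b =
          subst (λ c → Run S ρ ⌊ arg ▷ leq ⌋ (scalar a ∙ scalar b) ⌜ c ⌝ᵇ (weight (arg ▷ leq)) 0)
        (dec-false (a ≤? b) a≰b) (runLine (arg ▷ leq))

      errorSize : ∀ R D → queries R ℕ.≤ q → ∣ ⌜ R ⌝ ∣ ℕ.≤ N → ∣ ⌜ tree D ⌝ ∣ ℕ.≤ Dmax →
          ∣ scalar (Err R D) ∣ ℕ.≤ B
      errorSize R D R≤q R≤N D≤Dmax with error R D R≤q R≤N D≤Dmax
      ... | _ , d⇓ , c≤Pe = ℕₚ.≤-trans (output≤cost d⇓) (ℕₚ.≤-trans c≤Pe Pe≤B)

      module Step (i : Fin n) (M : List (Fin n)) (R : RDT n) (d : ℕ)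
        (D : Found (suc d) M R) (F₀ : Found d L (restrict i false R))
          (F₁ : Found d L (restrict i true R))
        (d≤B : ∣ ⌜ suc d ⌝ᵘ ∣ ℕ.≤ B) (M≤W : ∣ ⌜ i ∷ M ⌝ˡ ∣ ℕ.≤ W) (R≤q : queries R ℕ.≤ q)
          (R≤N : ∣ ⌜ R ⌝ ∣ ℕ.≤ N)
        (size : treeSize (suc d) ℕ.+ suc N ℕ.≤ Dmax) (complete : ∀ i → i ∈ L) where

        Q : DDT n
        Q = queryᴰ i (result F₀) (result F₁)

        candidateSize : ∀ (D′ : DDT n) → ∣ ⌜ tree D′ ⌝ᵗ ∣ ℕ.≤ treeSize (suc d) →
            ∣ ⌜ tree D′ ⌝ ∣ ℕ.≤ Dmax
        candidateSize D′ D′≤ =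
            ℕₚ.≤-trans (∙-mono ⌜ n ⌝ℕ ⌜ tree D′ ⌝ᵗ (ℕₚ.≤-trans (∣u∣≤∣u∙v∣ ⌜ n ⌝ℕ ⌜ R ⌝ᵗ) R≤N) D′≤)
          (ℕₚ.≤-trans (ℕₚ.≤-reflexive (ℕₚ.+-comm (suc N) (treeSize (suc d)))) size)

        i≤W : ∣ ⌜ toℕ i ⌝ℕ ∣ ℕ.≤ W
        i≤W = ℕₚ.≤-trans (∣u∣≤∣u∙v∣ ⌜ toℕ i ⌝ℕ ⌜ M ⌝ˡ) M≤W

        Qsize : ∣ ⌜ tree Q ⌝ᵗ ∣ ℕ.≤ treeSize (suc d)
        Qsize = ℕₚ.≤-trans
            (ℕₚ.≤-reflexive
              (solve 3 (λ x y z →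
                con 6 :+ (con 1 :+ (x :+ (con 1 :+ (y :+ z)))) := con 8 :+ x :+ (y :+ z))
            refl (∣ ⌜ toℕ i ⌝ℕ ∣) (∣ ⌜ tree (result F₀) ⌝ᵗ ∣) (∣ ⌜ tree (result F₁) ⌝ᵗ ∣)))
          (ℕₚ.+-mono-≤ (ℕₚ.m≤n⇒m≤n+o Pm (ℕₚ.+-monoʳ-≤ 8 i≤W)) (ℕₚ.+-mono-≤ (size≤ F₀) (size≤ F₁)))
          where open +-*-Solver

        Q≤ : queries (tree Q) ℕ.≤ suc d
        Q≤ = ℕ.s≤s (ℕₚ.⊔-lub (result≤d F₀) (result≤d F₁))

        Q-best : ∀ D₀ D₁ → suc (queries (tree D₀) ⊔ queries (tree D₁)) ℕ.≤ suc d →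
            Err R Q ≤ Err R (queryᴰ i D₀ D₁)
        Q-best D₀ D₁ h =
            query-optimal i R (result F₀) (result F₁) (optimal (λ _ → complete) F₀)
                (optimal (λ _ → complete) F₁) D₀ D₁
          (ℕₚ.m⊔n≤o⇒m≤o _ (queries (tree D₁)) (ℕ.s≤s⁻¹ h))
            (ℕₚ.m⊔n≤o⇒n≤o (queries (tree D₀)) _ (ℕ.s≤s⁻¹ h))

        Dt = ⌜ tree (result D) ⌝ᵗ
        Qt = ⌜ tree Q ⌝ᵗ

        aR : ⌜ R ⌝ ≲ 1
        aR = atom ⌜ R ⌝ (ℕₚ.≤-trans R≤N N≤B)

        aL : ⌜ L ⌝ˡ ≲ 1
        aL = atom ⌜ L ⌝ˡ (ℕₚ.≤-trans L≤W W≤B)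

        within-N : ∀ v w → ∣ v ∙ w ∣ ℕ.≤ N → (v ≲ 1) × (w ≲ 1)
        within-N v w vw≤ = atom v (ℕₚ.≤-trans (∣u∣≤∣u∙v∣ v w) (ℕₚ.≤-trans vw≤ N≤B)) ,
                           atom w (ℕₚ.≤-trans (∣v∣≤∣u∙v∣ v w) (ℕₚ.≤-trans vw≤ N≤B))

        within-Dmax : ∀ D′ → ∣ ⌜ tree D′ ⌝ᵗ ∣ ℕ.≤ treeSize (suc d) → ⌜ tree D′ ⌝ᵗ ≲ 1
        within-Dmax D′ D′≤ = atom ⌜ tree D′ ⌝ᵗ (ℕₚ.≤-trans (∣v∣≤∣u∙v∣ ⌜ n ⌝ℕ ⌜ tree D′ ⌝ᵗ)
          (ℕₚ.≤-trans (candidateSize D′ D′≤) Dmax≤B))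

        tree≤B : ∣ ⌜ R ⌝ᵗ ∣ ℕ.≤ B
        tree≤B = ℕₚ.≤-trans (∣v∣≤∣u∙v∣ ⌜ n ⌝ℕ ⌜ R ⌝ᵗ) (ℕₚ.≤-trans R≤N N≤B)

        runSubtreeCall : ∀ b (F : Found d L (restrict i b R)) →
          Run S ([] ▹ findBody) (subtree b) (state (suc d) (i ∷ M) R) ⌜ tree (result F) ⌝ᵗ
            _ (∣ ⌜ R ⌝ᵗ ∣ ℕ.* pass 3≤S ℕ.+ time d (length L))
        runSubtreeCall b F =
            runSeq (fit _ (atom ⌜ d ⌝ᵘ (ℕₚ.≤-trans (∣v∣≤∣u∙v∣ nil ⌜ d ⌝ᵘ) d≤B) ∙≲ aL ∙≲ aL ∙≲
              proj₁ (within-N ⌜ n ⌝ℕ ⌜ R ⌝ᵗ R≤N) ∙≲ atom ⌜ restrict i b R ⌝ᵗ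
                  (ℕₚ.≤-trans (∣restrict∣≤ i b R) tree≤B)))
          (runFork (runLine (tl dˡ))
            (runFork (runLine Lˡ) (runFork (runLine Lˡ) (runFork (runLine (hd Rˡ))
            (runSeq (fit _ (atom ⌜ b ⌝ᵇ (ℕₚ.≤-trans (∣⌜⌝ᵇ∣≤3 b) 3≤B) ∙≲ atom ⌜ toℕ i ⌝ℕ
              (ℕₚ.≤-trans i≤W W≤B) ∙≲ proj₂ (within-N ⌜ n ⌝ℕ ⌜ R ⌝ᵗ R≤N)))
              (runLine (lit ⌜ b ⌝ᵇ & hd Mˡ & tl Rˡ))
              (runRestriction 3≤S i b R))))))
          (runSelf (computed F))

        errors≤S : ∣ scalar (Err R (result D)) ∙ scalar (Err R Q) ∣ ℕ.≤ S
        errors≤S = fit _ (atom (scalar (Err R (result D)))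
            (errorSize R (result D) R≤q R≤N (candidateSize (result D) (size≤ D)))
          ∙≲ atom (scalar (Err R Q)) (errorSize R Q R≤q R≤N (candidateSize Q Qsize)))

        runErrors : Run S ([] ▹ findBody)
          ⟨ errorOf (hd arg) (hd (tl arg)) , errorOf (hd arg) (tl (tl arg)) ⟩
          (⌜ R ⌝ ∙ Dt ∙ Qt) (scalar (Err R (result D)) ∙ scalar (Err R Q)) _ (Pe ℕ.+ Pe)
        runErrors = runFork
          (runErrorOf (hd arg) (hd (tl arg)) _ R (result D) R≤q R≤N
            (candidateSize (result D) (size≤ D)) refl refl)
          (runErrorOf (hd arg) (tl (tl arg)) _ R Q R≤q R≤N (candidateSize Q Qsize) refl refl)

        -- The route to `choose` is the same for both verdicts. Raising the multiple of its branch
        -- to 30000 makes the total a closed numeral that `absorb` can test.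
        runs : ∀ {w a} {_ : T (a ℕ.≤ᵇ 30000)} →
            Run S ([] ▹ findBody) choose (⌜ R ⌝ ∙ Dt ∙ Qt) w a (Pe ℕ.+ Pe ℕ.+ 0 ℕ.+ 0) →
          Run S ([] ▹ findBody) findBody (state (suc d) (i ∷ M) R) w 0
              (time (suc d) (suc (length M)))
        runs {w} {a} {a≤} r = absorb bound
          (runThen 3≤S (runLine (dˡ ▷ pair?)) (runThen 3≤S (runLine (Mˡ ▷ pair?))
            (runSeq (fit _ (aR ∙≲ within-Dmax (result D) (size≤ D) ∙≲ within-Dmax Q Qsize))
              (runFork (runLine Rˡ) (runFork
                (runSeq (fit _ (atom ⌜ suc d ⌝ᵘ d≤B ∙≲ aL ∙≲ atom ⌜ M ⌝ˡ
                  (ℕₚ.≤-trans (∣v∣≤∣u∙v∣ ⌜ toℕ i ⌝ℕ ⌜ M ⌝ˡ) (ℕₚ.≤-trans M≤W W≤B)) ∙≲ aR))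
                  (runLine (dˡ & Lˡ & tl Mˡ & Rˡ)) (runSelf (computed D)))
                (runFork (runLine (lit ⌜ 1 ⌝ℕ)) (runFork (runLine (hd Mˡ))
                  (runFork (runSubtreeCall false F₀) (runSubtreeCall true F₁))))))
              (relax {b = 30000}
                (λ _ _ → ℕₚ.+-monoˡ-≤ _ (ℕₚ.*-monoʳ-≤ S (ℕₚ.≤ᵇ⇒≤ a 30000 a≤))) r))))
          where
          x = ∣ ⌜ R ⌝ᵗ ∣ ℕ.* pass 3≤S
          x≤ : x ℕ.≤ B ℕ.* pass 3≤S
          x≤ = ℕₚ.*-monoˡ-≤ (pass 3≤S) tree≤B
          t = time (suc d) (length M)
          f = time d (length L)
          bound : S ℕ.* unit ℕ.+ (t ℕ.+ ((x ℕ.+ f) ℕ.+ (x ℕ.+ f)) ℕ.+ (Pe ℕ.+ Pe ℕ.+ 0 ℕ.+ 0))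
              ℕ.≤ P ℕ.+ (t ℕ.+ (f ℕ.+ f))
          bound = begin
            S ℕ.* unit ℕ.+ (t ℕ.+ ((x ℕ.+ f) ℕ.+ (x ℕ.+ f)) ℕ.+ (Pe ℕ.+ Pe ℕ.+ 0 ℕ.+ 0))
              ≡⟨ solve 5 (λ s t x f e →
                  s :+ (t :+ ((x :+ f) :+ (x :+ f)) :+ (e :+ e :+ con 0 :+ con 0)) :=
                   s :+ ((x :+ x) :+ (e :+ e)) :+ (t :+ (f :+ f))) refl (S ℕ.* unit) t x f Pe ⟩
            S ℕ.* unit ℕ.+ ((x ℕ.+ x) ℕ.+ (Pe ℕ.+ Pe)) ℕ.+ (t ℕ.+ (f ℕ.+ f))
              ≤⟨ ℕₚ.+-monoˡ-≤ _ (ℕₚ.≤-trans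
                  (ℕₚ.+-monoʳ-≤ (S ℕ.* unit) (ℕₚ.+-monoˡ-≤ (Pe ℕ.+ Pe) (ℕₚ.+-mono-≤ x≤ x≤)))
                   (ℕₚ.m≤m+n _ Pm)) ⟩
            P ℕ.+ (t ℕ.+ (f ℕ.+ f)) ∎
            where
            open ℕₚ.≤-Reasoning
            open +-*-Solver

        better : Found (suc d) (i ∷ M) R
        better with Err R (result D) ≤? Err R Q
        ... | yes D≤Q = record
          { result    = result D
          ; result≤d  = result≤d D
          ; size≤     = size≤ D
          ; ≤constant = ≤constant D
          ; ≤query    = λ { (here refl) D₀ D₁ h → ≤-trans D≤Q (Q-best D₀ D₁ h)
                          ; (there i∈M) D₀ D₁ h → ≤query D i∈M D₀ D₁ h }
          ; computed  =
              runs (runThen 3≤S (runSeq errors≤S runErrors (runLeqTrue D≤Q))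
                  (runLine (hd (tl arg))))
          }
        ... | no D≰Q = record
          { result    = Q
          ; result≤d  = Q≤
          ; size≤     = Qsize
          ; ≤constant = λ c → ≤-trans Q≤D (≤constant D c)
          ; ≤query    = λ { (here refl) D₀ D₁ h → Q-best D₀ D₁ h
                          ; (there i∈M) D₀ D₁ h → ≤-trans Q≤D (≤query D i∈M D₀ D₁ h) }
          ; computed  =
              runs (runElse (runSeq errors≤S runErrors (runLeqFalse D≰Q)) (runLine (tl (tl arg))))
          }
          where
          Q≤D : Err R Q ≤ Err R (result D)
          Q≤D with total (Err R (result D)) (Err R Q)
          ... | inj₁ h = ⊥-elim (D≰Q h)
          ... | inj₂ h = h

      -- The recursion is lexicographic in the depth and the list. Restricting `R` preserves the
      -- bounds `q` and `N`, so the oracle hypotheses apply to every tree met.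
      found : ∀ d M R → ∣ ⌜ d ⌝ᵘ ∣ ℕ.≤ B → ∣ ⌜ M ⌝ˡ ∣ ℕ.≤ W → queries R ℕ.≤ q → ∣ ⌜ R ⌝ ∣ ℕ.≤ N →
        treeSize d ℕ.+ suc N ℕ.≤ Dmax → (1 ℕ.≤ d → ∀ i → i ∈ L) → Found d M R
      found zero M R _ _ R≤q R≤N _ _ = leafFound zero M R R≤q R≤N (λ _ _ _ ())
        (λ r → absorb S+Pm≤P (runElse (runLine (hd arg ▷ pair?)) r))
      found (suc d) [] R _ _ R≤q R≤N _ _ = leafFound (suc d) [] R R≤q R≤N (λ ())
        (λ r → absorb S+Pm≤P
          (runThen 3≤S (runLine (hd arg ▷ pair?)) (runElse (runLine (hd (tl (tl arg)) ▷ pair?)) r)))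
      found (suc d) (i ∷ M) R d≤B M≤W R≤q R≤N size complete with
          found (suc d) M R d≤B (ℕₚ.≤-trans (∣v∣≤∣u∙v∣ ⌜ toℕ i ⌝ℕ ⌜ M ⌝ˡ) M≤W) R≤q R≤N size complete
        | sub false | sub true
        where
        sub : ∀ b → Found d L (restrict i b R)
        sub b = found d L (restrict i b R) (ℕₚ.≤-trans (∣v∣≤∣u∙v∣ nil ⌜ d ⌝ᵘ) d≤B) L≤W
          (ℕₚ.≤-trans (queries-restrict i b R) R≤q)
          (ℕₚ.≤-trans (∙-mono ⌜ n ⌝ℕ ⌜ restrict i b R ⌝ᵗ ℕₚ.≤-refl (∣restrict∣≤ i b R)) R≤N)
          (ℕₚ.≤-trans (ℕₚ.+-monoˡ-≤ (suc N) (treeSize-suc d)) size)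
          (λ _ → complete (ℕ.s≤s ℕ.z≤n))
      ... | D | F₀ | F₁ = Step.better i M R d D F₀ F₁
        d≤B M≤W R≤q R≤N size (complete (ℕ.s≤s ℕ.z≤n))

      -- Each candidate root adds its own cost and two subsearches, three terms of at most P * base
      -- ^ d. The final call on the empty list counts as one more root.
      base : ℕ
      base = 3 ℕ.* suc (length L)

      private instance
        base≢0 : ℕ.NonZero base
        base≢0 = ℕₚ.m*n≢0 3 (suc (length L))

      P≤P*base^ : ∀ d → P ℕ.≤ P ℕ.* base ^ d
      P≤P*base^ d = ℕₚ.m≤m*n P (base ^ d) {{ℕₚ.m^n≢0 base d}}

      time-bound : ∀ d → time d (length L) ℕ.≤ P ℕ.* base ^ d
      time-bound zero    = P≤P*base^ 0
      time-bound (suc d) = begin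
        time (suc d) (length L)                        ≤⟨ roots (length L) ⟩
        suc (length L) ℕ.* ((P ℕ.* base ^ d) ℕ.* 3)    ≡⟨ solve 3
            (λ l p b → l :* ((p :* b) :* con 3) := p :* ((con 3 :* l) :* b))
                                                            refl (suc (length L)) P (base ^ d) ⟩
        P ℕ.* base ^ suc d                             ∎
        where
        open ℕₚ.≤-Reasoning
        open +-*-Solver
        x = P ℕ.* base ^ d
        roots : ∀ m → time (suc d) m ℕ.≤ suc m ℕ.* (x ℕ.* 3)
        roots zero    = ℕₚ.≤-trans (P≤P*base^ d) (ℕₚ.≤-trans (ℕₚ.m≤m*n x 3) (ℕₚ.m≤m+n (x ℕ.* 3) 0))
        roots (suc m) = begin
          P ℕ.+ (time (suc d) m ℕ.+ (time d (length L) ℕ.+ time d (length L)))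
            ≤⟨ ℕₚ.+-mono-≤ (P≤P*base^ d)
                (ℕₚ.+-mono-≤ (roots m) (ℕₚ.+-mono-≤ (time-bound d) (time-bound d))) ⟩
          x ℕ.+ (suc m ℕ.* (x ℕ.* 3) ℕ.+ (x ℕ.+ x))
            ≡⟨ solve 2 (λ x y → x :+ (y :+ (x :+ x)) := x :* con 3 :+ y) refl x
                (suc m ℕ.* (x ℕ.* 3)) ⟩
          suc (suc m) ℕ.* (x ℕ.* 3) ∎

    -- Trying the depths in turn

    ∣⌜_⌝ᵘ∣ : ∀ d → ∣ ⌜ d ⌝ᵘ ∣ ≡ suc (d ℕ.* 2)
    ∣⌜ zero ⌝ᵘ∣  = refl
    ∣⌜ suc d ⌝ᵘ∣ = cong (2 ℕ.+_) ∣⌜ d ⌝ᵘ∣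

    -- Bounds on lists and indices are conditional on 1 ≤ q⋆, since only then does n ^ q⋆, and with
    -- it `ν`, dominate n.
    module Loop {q⋆ ν Q : ℕ} (R : RDT n) (ε : Carrier)
      (R≤q : queries R ℕ.≤ q) (R≤N : ∣ ⌜ R ⌝ ∣ ℕ.≤ N) (ε≤B : ∣ scalar ε ∣ ℕ.≤ B)
      (q⋆≤B : suc (q⋆ ℕ.* 2) ℕ.≤ B) (size : treeSize q⋆ ℕ.+ suc N ℕ.≤ Dmax)
      (reachable : ∃[ D ] queries (tree D) ℕ.≤ q⋆ × Err R D ≤ ε)
      (n≤ν : 1 ℕ.≤ q⋆ → n ℕ.≤ ν)
      (all≤W : 1 ℕ.≤ q⋆ → ∣ ⌜ allFin n ⌝ˡ ∣ ℕ.≤ W)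
      (index≤B : 1 ℕ.≤ q⋆ → ∀ i → i ℕ.≤ n → ∣ ⌜ i ⌝ℕ ∣ ℕ.≤ B)
      (base^q⋆≤Q : (3 ℕ.* suc n) ^ q⋆ ℕ.≤ Q)
      (q⋆<Q : q⋆ ℕ.< Q)
      where

      loopState : ℕ → List (Fin n) → Val
      loopState d L = ⌜ d ⌝ᵘ ∙ ⌜ L ⌝ˡ ∙ ⌜ R ⌝ ∙ scalar ε

      X : ℕ
      X = P ℕ.* Q

      round : ℕ
      round = S ℕ.* unit ℕ.+ (X ℕ.+ Pe ℕ.+ suc ν ℕ.* pass 3≤S)

      record Success (d : ℕ) (L : List (Fin n)) (g : ℕ) : Set where
        field
          output   : DDT n
          output≤  : queries (tree output) ℕ.≤ q⋆
          accurate : Err R output ≤ ε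
          small    : ∣ ⌜ tree output ⌝ ∣ ℕ.≤ Dmax
          computes : Run S ([] ▹ loopBody) loopBody (loopState d L) ⌜ tree output ⌝ 0
              (suc g ℕ.* round)
      open Success public

      time≤ : ∀ L (L≤W : ∣ ⌜ L ⌝ˡ ∣ ℕ.≤ W) → length L ℕ.≤ n → ∀ d → d ℕ.≤ q⋆ →
          Level.time L L≤W d (length L) ℕ.≤ X
      time≤ L L≤W L≤n d d≤q⋆ = begin
        Level.time L L≤W d (length L)     ≤⟨ Level.time-bound L L≤W d ⟩
        P ℕ.* (3 ℕ.* suc (length L)) ^ d  ≤⟨ ℕₚ.*-monoʳ-≤ P
            (ℕₚ.^-monoˡ-≤ d (ℕₚ.*-monoʳ-≤ 3 (ℕ.s≤s L≤n))) ⟩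
        P ℕ.* (3 ℕ.* suc n) ^ d           ≤⟨ ℕₚ.*-monoʳ-≤ P
            (ℕₚ.^-monoʳ-≤ (3 ℕ.* suc n) {{ℕₚ.m*n≢0 3 (suc n)}} d≤q⋆) ⟩
        P ℕ.* (3 ℕ.* suc n) ^ q⋆          ≤⟨ ℕₚ.*-monoʳ-≤ P base^q⋆≤Q ⟩
        X                                 ∎
        where open ℕₚ.≤-Reasoning

      module Round (g d : ℕ) (L : List (Fin n)) (L≤W : ∣ ⌜ L ⌝ˡ ∣ ℕ.≤ W) (L≤n : length L ℕ.≤ n)
        (d+g≡q⋆ : d ℕ.+ g ≡ q⋆) (complete : 1 ℕ.≤ d → ∀ i → i ∈ L) where

        open Level L L≤W
        d≤q⋆ : d ℕ.≤ q⋆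
        d≤q⋆ = ℕₚ.m+n≤o⇒m≤o d (ℕₚ.≤-reflexive d+g≡q⋆)
        d≤B : ∣ ⌜ d ⌝ᵘ ∣ ℕ.≤ B
        d≤B = ℕₚ.≤-trans (ℕₚ.≤-reflexive ∣⌜ d ⌝ᵘ∣) (ℕₚ.≤-trans (ℕ.s≤s (ℕₚ.*-monoˡ-≤ 2 d≤q⋆)) q⋆≤B)
        size-d : treeSize d ℕ.+ suc N ℕ.≤ Dmax
        size-d = ℕₚ.≤-trans (ℕₚ.+-monoˡ-≤ (suc N) (treeSize-mono d≤q⋆)) size
        D : Found d L R
        D = found d L R d≤B L≤W R≤q R≤N size-d complete
        F : DDT n
        F = result D
        F≤Dmax : ∣ ⌜ tree F ⌝ ∣ ℕ.≤ Dmax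
        F≤Dmax = ℕₚ.≤-trans
            (∙-mono ⌜ n ⌝ℕ ⌜ tree F ⌝ᵗ (ℕₚ.≤-trans (∣u∣≤∣u∙v∣ ⌜ n ⌝ℕ ⌜ R ⌝ᵗ) R≤N) (size≤ D))
          (ℕₚ.≤-trans (ℕₚ.≤-reflexive (ℕₚ.+-comm (suc N) (treeSize d))) size-d)
        Ft = ⌜ tree F ⌝ᵗ
        aF : Ft ≲ 1
        aF = atom Ft (ℕₚ.≤-trans (∣v∣≤∣u∙v∣ ⌜ n ⌝ℕ Ft) (ℕₚ.≤-trans F≤Dmax Dmax≤B))
        aR : ⌜ R ⌝ ≲ 1
        aR = atom ⌜ R ⌝ (ℕₚ.≤-trans R≤N N≤B)
        an : ⌜ n ⌝ℕ ≲ 1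
        an = atom ⌜ n ⌝ℕ (ℕₚ.≤-trans (∣u∣≤∣u∙v∣ ⌜ n ⌝ℕ ⌜ R ⌝ᵗ) (ℕₚ.≤-trans R≤N N≤B))
        aL : ⌜ L ⌝ˡ ≲ 1
        aL = atom ⌜ L ⌝ˡ (ℕₚ.≤-trans L≤W W≤B)
        aε : scalar ε ≲ 1
        aε = atom (scalar ε) ε≤B
        as : loopState d L ≲ 7
        as = atom ⌜ d ⌝ᵘ d≤B ∙≲ aL ∙≲ aR ∙≲ aε

        runs : ∀ {w a x} {a≤ : T (a ℕ.≤ᵇ 50000)} →
            time d (length L) ℕ.+ x ℕ.≤ X ℕ.+ Pe ℕ.+ suc ν ℕ.* pass 3≤S ℕ.+ g ℕ.* round →
          Run S ([] ▹ loopBody)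
            (ifte (⟨ errorOf Iˡ (tl arg) , ⌊ tl (tl (tl sˡ)) ⌋ ⟩ ⨾ ⌊ arg ▷ leq ⌋)
              ⌊ hd Iˡ & tl arg ⌋
              (⟨ ⌊ lit nil & hd sˡ ⌋ , ⟨ ⌊ lit nil & hd Iˡ ⌋ ⨾ range , ⌊ tl (tl sˡ) ⌋ ⟩ ⟩ ⨾ self))
            (loopState d L ∙ Ft) w a x →
          Run S ([] ▹ loopBody) loopBody (loopState d L) w 0 (suc g ℕ.* round)
        runs {a = a} {a≤ = a≤} h r = absorb
          (ℕₚ.≤-trans (ℕₚ.+-monoʳ-≤ (S ℕ.* unit) h)
            (ℕₚ.≤-reflexive (sym (ℕₚ.+-assoc (S ℕ.* unit) _ (g ℕ.* round)))))
          (runSeq (fit (loopState d L ∙ Ft) (as ∙≲ aF))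
            (runFork (runLine arg)
              (runSeq (fit (state d L R) (atom ⌜ d ⌝ᵘ d≤B ∙≲ aL ∙≲ aL ∙≲ aR))
                (runLine (hd arg & hd (tl arg) & hd (tl arg) & hd (tl (tl arg))))
                (run↑ (runRec (computed D)))))
            (relax {b = 50000} (λ _ _ → ℕₚ.+-monoˡ-≤ _ (ℕₚ.*-monoʳ-≤ S (ℕₚ.≤ᵇ⇒≤ a 50000 a≤))) r))

        runErrors : Run S ([] ▹ loopBody) ⟨ errorOf Iˡ (tl arg) , ⌊ tl (tl (tl sˡ)) ⌋ ⟩
            (loopState d L ∙ Ft)
          (scalar (Err R F) ∙ scalar ε) _ (Pe ℕ.+ 0)
        runErrors = runFork (runErrorOf Iˡ (tl arg) _ R F R≤q R≤N F≤Dmax refl refl)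
            (runLine (tl (tl (tl sˡ))))

        errors≤S : ∣ scalar (Err R F) ∙ scalar ε ∣ ℕ.≤ S
        errors≤S = fit _ (atom (scalar (Err R F)) (errorSize R F R≤q R≤N F≤Dmax) ∙≲ aε)

        t≤X : time d (length L) ℕ.≤ X
        t≤X = time≤ L L≤W L≤n d d≤q⋆

        -- The next round is passed in as `retry`, so that one proof treats both outcomes of the
        -- test. In the last round `retry` is a refutation of failure.
        verdict : (¬ Err R F ≤ ε → ∃[ g′ ] g ≡ suc g′ × Success (suc d) (allFin n) g′) →
            Success d L g
        verdict retry with Err R F ≤? ε
        ... | yes F≤ε = record
          { output   = F
          ; output≤  = ℕₚ.≤-trans (result≤d D) d≤q⋆
          ; accurate = F≤ε
          ; small    = F≤Dmax
          ; computes = runs bound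
              (runThen 3≤S (runSeq errors≤S runErrors (runLeqTrue F≤ε)) (runLine (hd Iˡ & tl arg)))
          }
          where
          bound : time d
              (length L) ℕ.+ (Pe ℕ.+ 0 ℕ.+ 0 ℕ.+ 0)
                ℕ.≤ X ℕ.+ Pe ℕ.+ suc ν ℕ.* pass 3≤S ℕ.+ g ℕ.* round
          bound = ℕₚ.≤-trans
              (ℕₚ.≤-reflexive
                (solve 2 (λ t e → t :+ (e :+ con 0 :+ con 0 :+ con 0) := t :+ e) refl
                  (time d (length L)) Pe))
            (ℕₚ.≤-trans (ℕₚ.+-monoˡ-≤ Pe t≤X) (ℕₚ.m≤n⇒m≤n+o _ (ℕₚ.m≤m+n (X ℕ.+ Pe) _)))
            where open +-*-Solver
        ... | no F≰ε with retry F≰ε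
        ... | g′ , refl , next = record
          { output   = output next
          ; output≤  = output≤ next
          ; accurate = accurate next
          ; small    = small next
          ; computes = runs bound (runElse (runSeq errors≤S runErrors (runLeqFalse F≰ε))
              (runSeq (fit (loopState (suc d) (allFin n))
                (atom ⌜ suc d ⌝ᵘ suc-d≤B ∙≲ atom ⌜ allFin n ⌝ˡ
                  (ℕₚ.≤-trans (all≤W 1≤q⋆) W≤B) ∙≲ aR ∙≲ aε))
                (runFork (runLine (lit nil & hd sˡ))
                  (runFork (runSeq (fit (nil ∙ ⌜ n ⌝ℕ) (atom nil 1≤B ∙≲ an))
                    (runLine (lit nil & hd Iˡ))
                      (runRange 3≤S n
                        (λ i i≤n → fit (⌜ i ⌝ℕ ∙ ⌜ n ⌝ℕ) (atom ⌜ i ⌝ℕ (index≤B 1≤q⋆ i i≤n) ∙≲ an))))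
                    (runLine (tl (tl sˡ)))))
                (runSelf (computes next))))
          }
          where
          suc-d≤q⋆ : suc d ℕ.≤ q⋆
          suc-d≤q⋆ = ℕₚ.≤-trans (ℕₚ.m≤m+n (suc d) g′)
              (ℕₚ.≤-reflexive (trans (sym (ℕₚ.+-suc d g′)) d+g≡q⋆))
          1≤q⋆ : 1 ℕ.≤ q⋆
          1≤q⋆ = ℕₚ.≤-trans (ℕ.s≤s ℕ.z≤n) suc-d≤q⋆
          suc-d≤B : ∣ ⌜ suc d ⌝ᵘ ∣ ℕ.≤ B
          suc-d≤B = ℕₚ.≤-trans (ℕₚ.≤-reflexive ∣⌜ suc d ⌝ᵘ∣)
              (ℕₚ.≤-trans (ℕ.s≤s (ℕₚ.*-monoˡ-≤ 2 suc-d≤q⋆)) q⋆≤B)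
          k = pass 3≤S
          bound : time d
              (length L) ℕ.+ (Pe ℕ.+ 0 ℕ.+ 0 ℕ.+ (suc n ℕ.* k ℕ.+ 0 ℕ.+ suc g′ ℕ.* round))
                    ℕ.≤ X ℕ.+ Pe ℕ.+ suc ν ℕ.* k ℕ.+ suc g′ ℕ.* round
          bound = begin
            time d (length L) ℕ.+ (Pe ℕ.+ 0 ℕ.+ 0 ℕ.+ (suc n ℕ.* k ℕ.+ 0 ℕ.+ suc g′ ℕ.* round))
              ≡⟨ solve 4 (λ t e r s →
                  t :+ (e :+ con 0 :+ con 0 :+ (r :+ con 0 :+ s)) := t :+ e :+ r :+ s) refl
                   (time d (length L)) Pe (suc n ℕ.* k) (suc g′ ℕ.* round) ⟩
            time d (length L) ℕ.+ Pe ℕ.+ suc n ℕ.* k ℕ.+ suc g′ ℕ.* round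
              ≤⟨ ℕₚ.+-monoˡ-≤ (suc g′ ℕ.* round)
                  (ℕₚ.+-mono-≤ (ℕₚ.+-monoˡ-≤ Pe t≤X) (ℕₚ.*-monoˡ-≤ k (ℕ.s≤s (n≤ν 1≤q⋆)))) ⟩
            X ℕ.+ Pe ℕ.+ suc ν ℕ.* k ℕ.+ suc g′ ℕ.* round ∎
            where
            open ℕₚ.≤-Reasoning
            open +-*-Solver

      -- The fuel `g` is q⋆ - d. At depth q⋆ the optimal tree does at least as well as the witness
      -- in `reachable`, so the test cannot fail when the fuel is spent.
      loop : ∀ g d L → ∣ ⌜ L ⌝ˡ ∣ ℕ.≤ W → length L ℕ.≤ n → d ℕ.+ g ≡ q⋆ →
          (1 ℕ.≤ d → ∀ i → i ∈ L) → Success d L g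
      loop zero d L L≤W L≤n d+0≡q⋆ complete = verdict λ F≰ε → ⊥-elim (F≰ε (≤-trans
          (proj₂ (Level.optimal L L≤W complete D) D⋆
            (ℕₚ.≤-trans D⋆≤ (ℕₚ.≤-reflexive (trans (sym d+0≡q⋆) (ℕₚ.+-identityʳ d))))) D⋆≤ε))
        where
        open Round zero d L L≤W L≤n d+0≡q⋆ complete
        D⋆ = proj₁ reachable
        D⋆≤ = proj₁ (proj₂ reachable)
        D⋆≤ε = proj₂ (proj₂ reachable)
      loop (suc g) d L L≤W L≤n d+g≡q⋆ complete = verdict λ _ → g , refl ,
          loop g (suc d) (allFin n)
            (all≤W (ℕₚ.≤-trans (ℕ.s≤s ℕ.z≤n)
              (ℕₚ.≤-trans (ℕₚ.m≤n+m (suc g) d) (ℕₚ.≤-reflexive d+g≡q⋆))))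
            (ℕₚ.≤-reflexive (length-tabulate (λ i → i)))
            (trans (sym (ℕₚ.+-suc d g)) d+g≡q⋆) (λ _ → ∈-allFin)
        where open Round (suc g) d L L≤W L≤n d+g≡q⋆ complete

      instanceOpt-correct : 1 ℕ.≤ W → ∃[ D ] (instanceOpt on (⌜ R ⌝ ∙ scalar ε) returns ⌜ tree D ⌝
                within ⟦ costPoly ⟧ (B ∷ Pe ∷ Pm ∷ Q ∷ ν ∷ []))
           × queries (tree D) ℕ.≤ q⋆ × Err R D ≤ ε
      instanceOpt-correct 1≤W with loop q⋆ 0 [] 1≤W ℕ.z≤n refl (λ ())
      ... | success = output success ,
        returns (bounded (absorb ℕₚ.≤-refl
            (runSeq (fit (loopState 0 []) (atom nil 1≤B ∙≲ atom nil 1≤B ∙≲ aI))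
              (runLine (lit nil & lit nil & arg)) (runRec (computes success))))
            (fit _ aI) (fit ⌜ tree (output success) ⌝
              (atom _ (ℕₚ.≤-trans (small success) Dmax≤B)))) ,
        output≤ success , accurate success
        where
        aI : (⌜ R ⌝ ∙ scalar ε) ≲ 3
        aI = atom ⌜ R ⌝ (ℕₚ.≤-trans R≤N N≤B) ∙≲ atom (scalar ε) ε≤B
        returns : ∀ {w} →
          ∃[ c ] ([] ⊢ instanceOpt · ⌜ R ⌝ ∙ scalar ε ⇓ w ⟨ c ⟩) × c
              ℕ.≤ S ℕ.* 0 ℕ.+ (S ℕ.* unit ℕ.+ suc q⋆ ℕ.* round) →
          instanceOpt on (⌜ R ⌝ ∙ scalar ε) returns w within (S ℕ.* unit ℕ.+ Q ℕ.* round)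
        returns (c , c⇓ , c≤) = c , c⇓ , ℕₚ.≤-trans c≤
          (ℕₚ.+-mono-≤ (ℕₚ.≤-reflexive (ℕₚ.*-zeroʳ S))
            (ℕₚ.+-monoʳ-≤ (S ℕ.* unit) (ℕₚ.*-monoˡ-≤ round q⋆<Q)))

-- The polynomial time bound

_[_]ᵖ : ∀ {m k} → Poly m → Vec (Poly k) m → Poly k
con c [ σ ]ᵖ   = con c
var i [ σ ]ᵖ   = lookup σ i
(p ⊕ r) [ σ ]ᵖ = (p [ σ ]ᵖ) ⊕ (r [ σ ]ᵖ)
(p ⊗ r) [ σ ]ᵖ = (p [ σ ]ᵖ) ⊗ (r [ σ ]ᵖ)

-- Coefficients are natural numbers, so polynomials are monotone and upper bounds may be substituted
-- for their variables.
⟦⟧-mono-subst : ∀ {m k} (p : Poly m) (σ : Vec (Poly k) m) as bs →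
  Pointwise (λ b s → b ℕ.≤ ⟦ s ⟧ as) bs σ → ⟦ p ⟧ bs ℕ.≤ ⟦ p [ σ ]ᵖ ⟧ as
⟦⟧-mono-subst (con c) σ as bs bs≤ = ℕₚ.≤-refl
⟦⟧-mono-subst (var i) σ as bs bs≤ = Pointwise.lookup bs≤ i
⟦⟧-mono-subst (p ⊕ r) σ as bs bs≤ =
    ℕₚ.+-mono-≤ (⟦⟧-mono-subst p σ as bs bs≤) (⟦⟧-mono-subst r σ as bs bs≤)
⟦⟧-mono-subst (p ⊗ r) σ as bs bs≤ =
    ℕₚ.*-mono-≤ (⟦⟧-mono-subst p σ as bs bs≤) (⟦⟧-mono-subst r σ as bs bs≤)

^-distribʳ-* : ∀ m n o → (m ℕ.* n) ^ o ≡ m ^ o ℕ.* n ^ o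
^-distribʳ-* m n zero    = refl
^-distribʳ-* m n (suc o) = trans (cong (m ℕ.* n ℕ.*_) (^-distribʳ-* m n o))
  (solve 4 (λ x y z w → x :* y :* (z :* w) := x :* z :* (y :* w)) refl m n (m ^ o) (n ^ o))
  where open +-*-Solver

-- For n ≥ 2, both 3 and 1 + n are at most n * n. The constant 6 is the left side at n = q = 1. For
-- n ≤ 1 powers of n do not grow with q, whence the two hypotheses.
^-suc-bound : ∀ n q → (n ≡ 0 → q ≡ 0) → (n ≡ 1 → q ℕ.≤ 1) →
  (3 ℕ.* suc n) ^ q ℕ.≤ 6 ℕ.* ((n ^ q ℕ.* n ^ q) ℕ.* (n ^ q ℕ.* n ^ q))
^-suc-bound n zero _ _ = ℕ.s≤s ℕ.z≤n
^-suc-bound zero (suc q) q≡0 _ with () ← q≡0 refl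
^-suc-bound (suc zero) (suc q) _ q≤1 with ℕ.s≤s ℕ.z≤n ← q≤1 refl = ℕₚ.≤-refl
^-suc-bound n@(suc (suc m)) q@(suc _) _ _ = begin
  (3 ℕ.* suc n) ^ q                       ≤⟨ ℕₚ.^-monoˡ-≤ q 3*[1+n]≤n⁴ ⟩
  ((n ℕ.* n) ℕ.* (n ℕ.* n)) ^ q           ≡⟨ ^-distribʳ-* (n ℕ.* n) (n ℕ.* n) q ⟩
  (n ℕ.* n) ^ q ℕ.* (n ℕ.* n) ^ q         ≡⟨ cong₂ ℕ._*_ (^-distribʳ-* n n q) (^-distribʳ-* n n q) ⟩
  (n ^ q ℕ.* n ^ q) ℕ.* (n ^ q ℕ.* n ^ q) ≤⟨ ℕₚ.m≤n*m _ 6 ⟩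
  6 ℕ.* ((n ^ q ℕ.* n ^ q) ℕ.* (n ^ q ℕ.* n ^ q)) ∎
  where
  open ℕₚ.≤-Reasoning
  2≤n : 2 ℕ.≤ n
  2≤n = ℕ.s≤s (ℕ.s≤s ℕ.z≤n)
  1+n≤n² : suc n ℕ.≤ n ℕ.* n
  1+n≤n² = ℕₚ.≤-trans (ℕₚ.+-monoˡ-≤ n {1} {n} (ℕ.s≤s ℕ.z≤n))
    (ℕₚ.≤-trans (ℕₚ.+-monoʳ-≤ n {n} {n ℕ.+ 0} (ℕₚ.m≤m+n n 0)) (ℕₚ.*-monoˡ-≤ n 2≤n))
  3*[1+n]≤n⁴ : 3 ℕ.* suc n ℕ.≤ (n ℕ.* n) ℕ.* (n ℕ.* n)
  3*[1+n]≤n⁴ = ℕₚ.*-mono-≤ {3} {n ℕ.* n} (ℕₚ.≤-trans (ℕₚ.n≤1+n 3) (ℕₚ.*-mono-≤ 2≤n 2≤n)) 1+n≤n²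

suc≤2^ : ∀ q → suc q ℕ.≤ 2 ^ q
suc≤2^ zero    = ℕₚ.≤-refl
suc≤2^ (suc q) =
    ℕₚ.+-mono-≤ {1} {2 ^ q} (ℕₚ.≤-trans (ℕ.s≤s ℕ.z≤n) (suc≤2^ q))
        (ℕₚ.≤-trans (suc≤2^ q) (ℕₚ.m≤m+n _ 0))

n≤n^ : ∀ n {q} → 1 ℕ.≤ q → n ℕ.≤ n ^ q
n≤n^ zero 1≤q = ℕ.z≤n
n≤n^ n@(suc _) 1≤q = ℕₚ.≤-trans (ℕₚ.≤-reflexive (sym (ℕₚ.^-identityʳ n))) (ℕₚ.^-monoʳ-≤ n 1≤q)

module _ (𝕂 : Scalars) where
  open Scalars 𝕂
  open Theory 𝕂
  open Machine 𝕂
  open Restriction 𝕂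

  -- A digit adds at most 4 to the code and at least 1 to the value. This linear bound is crude but
  -- suffices, as it is used only when n ≤ n ^ q⋆.
  ∣⌜⌝₂∣-bound : ∀ x → ∣ ⌜ x ⌝₂ ∣ ℕ.≤ 1 ℕ.+ 4 ℕ.* ℕᵇ.toℕ x
  ∣⌜⌝₂∣-bound ℕᵇ.zero = ℕₚ.≤-refl
  ∣⌜⌝₂∣-bound 2[1+ x ] = ℕₚ.≤-trans (ℕₚ.+-monoʳ-≤ 2 (∣⌜⌝₂∣-bound x))
    (ℕₚ.≤-trans (ℕₚ.m≤m+n _ (6 ℕ.+ 4 ℕ.* ℕᵇ.toℕ x))
      (ℕₚ.≤-reflexive
        (solve 1 (λ t →
          con 3 :+ con 4 :* t :+ (con 6 :+ con 4 :* t) := con 1 :+ con 4 :*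
              (con 2 :* (con 1 :+ t))) refl (ℕᵇ.toℕ x))))
    where open +-*-Solver
  ∣⌜⌝₂∣-bound 1+[2 x ] = ℕₚ.≤-trans (ℕₚ.+-monoʳ-≤ 4 (∣⌜⌝₂∣-bound x))
    (ℕₚ.≤-trans (ℕₚ.m≤m+n _ (4 ℕ.* ℕᵇ.toℕ x))
      (ℕₚ.≤-reflexive
        (solve 1 (λ t →
          con 5 :+ con 4 :* t :+ con 4 :* t := con 1 :+ con 4 :* (con 1 :+ con 2 :* t)) refl
              (ℕᵇ.toℕ x))))
    where open +-*-Solver

  ∣⌜⌝ℕ∣-bound : ∀ {i n} → i ℕ.≤ n → ∣ ⌜ i ⌝ℕ ∣ ℕ.≤ 1 ℕ.+ 4 ℕ.* n
  ∣⌜⌝ℕ∣-bound {i} {n} i≤n = ℕₚ.≤-trans (∣⌜⌝₂∣-bound (ℕᵇ.fromℕ i))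
    (ℕ.s≤s (ℕₚ.*-monoʳ-≤ 4 (ℕₚ.≤-trans (ℕₚ.≤-reflexive (ℕᵇₚ.toℕ-fromℕ i)) i≤n)))

  ∣⌜⌝ˡ∣-bound : ∀ {n} (M : List (Fin n)) → ∣ ⌜ M ⌝ˡ ∣ ℕ.≤ 1 ℕ.+ length M ℕ.* (2 ℕ.+ 4 ℕ.* n)
  ∣⌜⌝ˡ∣-bound [] = ℕₚ.≤-refl
  ∣⌜⌝ˡ∣-bound {n} (i ∷ M) = ℕₚ.≤-trans
    (∙-mono ⌜ toℕ i ⌝ℕ ⌜ M ⌝ˡ (∣⌜⌝ℕ∣-bound (ℕₚ.<⇒≤ (Finₚ.toℕ<n i))) (∣⌜⌝ˡ∣-bound M))
    (ℕₚ.≤-reflexive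
      (solve 2 (λ x y → con 1 :+ (con 1 :+ x :+ (con 1 :+ y)) := con 1 :+ (con 2 :+ x :+ y)) refl
      (4 ℕ.* n) (length M ℕ.* (2 ℕ.+ 4 ℕ.* n))))
    where open +-*-Solver

  module _ (ℰ : ErrorMetric) (natural : Natural ℰ) where
    open Optimality ℰ natural

    optimum-zero-variables : ∀ {R : RDT 0} {ε q⋆} → q⋆ IsOptimalFor ℰ , R , ε → q⋆ ≡ 0
    optimum-zero-variables {R} {ε} ((D , _ , D≤ε) , least) =
        ℕₚ.n≤0⇒n≡0 (least 0 (D , noQueries (shape D) , D≤ε))
      where
      noQueries : ∀ {D : DDT 0} → Shape D → queries (tree D) ℕ.≤ 0
      noQueries (isConstant _) = ℕ.z≤n
      noQueries (isQuery () _ _)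

    -- A single query reveals the whole input, so an accurate tree can be replaced by one of depth 1
    -- that computes the same function.
    optimum-one-variable : ∀ {R : RDT 1} {ε q⋆} → q⋆ IsOptimalFor ℰ , R , ε → q⋆ ℕ.≤ 1
    optimum-one-variable {R} {ε} ((D , _ , D≤ε) , least) =
        least 1 (D′ , ℕₚ.≤-refl , subst (_≤ ε)
            (Err-cong {R = R} {R} {D} {D′} (λ _ → refl) same) D≤ε)
      where
      D′ : DDT 1
      D′ = queryᴰ 0F (constant (evaluate D (false ∷ []))) (constant (evaluate D (true ∷ [])))
      same : ∀ x → evaluate D x ≡ evaluate D′ x
      same (false ∷ []) = refl
      same (true ∷ [])  = refl

-- Choice of the bounds and assembly

module Bound (𝕂 : Scalars) (A-err A-min : Theory.Algorithm 𝕂)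
  (ℰ : Theory.ErrorMetric 𝕂) (natural : Theory.Natural 𝕂 ℰ) where
  open Scalars 𝕂
  open Theory 𝕂
  open Machine 𝕂
  open Restriction 𝕂
  open Optimality ℰ natural
  open Search 𝕂 A-err A-min

  -- The bounds are variables tied by inequalities that mirror the polynomials of `Polynomial`, so
  -- the estimates are made without unfolding those. In the end the inequalities hold by
  -- reflexivity.
  within-budget : ∀ {n q q⋆ N W Pm Pe Dmax B Q ν b} (R : RDT n) (ε : Carrier) →
    queries R ℕ.≤ q → descriptionLength R ℕ.≤ N → q⋆ IsOptimalFor ℰ , R , ε → n ^ q⋆ ℕ.≤ ν →
    6 ℕ.* ((ν ℕ.* ν) ℕ.* (ν ℕ.* ν)) ℕ.≤ Q →
    1 ℕ.+ ν ℕ.* (2 ℕ.+ 4 ℕ.* ν) ℕ.≤ W →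
    Q ℕ.* (2 ℕ.* (8 ℕ.+ W ℕ.+ Pm)) ℕ.+ (1 ℕ.+ N) ℕ.≤ Dmax →
    3 ℕ.+ (N ℕ.+ (W ℕ.+ (Dmax ℕ.+ (Pe ℕ.+
      ((1 ℕ.+ size ε) ℕ.+ ((1 ℕ.+ Q ℕ.* 2) ℕ.+ (1 ℕ.+ 4 ℕ.* ν))))))) ℕ.≤ B →
    (∀ (R : RDT n) → queries R ℕ.≤ q → ∣ ⌜ R ⌝ ∣ ℕ.≤ N →
      ∃[ c ] c IsConstantMinimizerOf ℰ for R × A-min on ⌜ R ⌝ returns scalar (value c) within Pm) →
    (∀ (R : RDT n) D → queries R ℕ.≤ q → ∣ ⌜ R ⌝ ∣ ℕ.≤ N → ∣ ⌜ tree D ⌝ ∣ ℕ.≤ Dmax →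
      A-err on (⌜ R ⌝ ∙ ⌜ tree D ⌝) returns scalar (value (ℰ R D)) within Pe) →
    ⟦ costPoly ⟧ (B ∷ Pe ∷ Pm ∷ Q ∷ ν ∷ []) ℕ.≤ b →
    ∃[ D ] (instanceOpt on (⌜ R ⌝ ∙ scalar ε) returns ⌜ tree D ⌝ within b)
         × queries (tree D) ℕ.≤ q⋆
         × value (ℰ R D) ≤ ε
  within-budget {n} {q} {q⋆} {N} {W} {Pm} {Pe} {Dmax} {B} {Q} {ν}
      R ε R≤q R≤N optimum ν≥ Q≥ W≥ Dmax≥ B≥ minimizer error b≥ =
    let D , (c , c⇓ , c≤) , D≤q⋆ , D≤ε = instanceOpt-correct (ℕₚ.≤-trans (ℕ.s≤s ℕ.z≤n) W≥)
    in D , (c , c⇓ , ℕₚ.≤-trans c≤ b≥) , D≤q⋆ , D≤ε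
    where
    base^q⋆≤Q : (3 ℕ.* suc n) ^ q⋆ ℕ.≤ Q
    base^q⋆≤Q = ℕₚ.≤-trans
        (^-suc-bound n q⋆ (λ { refl → optimum-zero-variables 𝕂 ℰ natural optimum })
          (λ { refl → optimum-one-variable 𝕂 ℰ natural optimum }))
      (ℕₚ.≤-trans (ℕₚ.*-monoʳ-≤ 6 (ℕₚ.*-mono-≤ (ℕₚ.*-mono-≤ ν≥ ν≥) (ℕₚ.*-mono-≤ ν≥ ν≥))) Q≥)

    -- Because 2 ≤ 3 * (1 + n) even for n = 0, `Q` also bounds the number of rounds and the growth
    -- of trees with depth.
    2^q⋆≤Q : 2 ^ q⋆ ℕ.≤ Q
    2^q⋆≤Q = ℕₚ.≤-trans (ℕₚ.^-monoˡ-≤ q⋆ {2} {3 ℕ.* suc n}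
      (ℕₚ.≤-trans (ℕₚ.n≤1+n 2) (ℕₚ.*-monoʳ-≤ 3 (ℕ.s≤s {0} {n} ℕ.z≤n)))) base^q⋆≤Q

    q⋆<Q : q⋆ ℕ.< Q
    q⋆<Q = ℕₚ.≤-trans (suc≤2^ q⋆) 2^q⋆≤Q

    n≤ν : 1 ℕ.≤ q⋆ → n ℕ.≤ ν
    n≤ν 1≤q⋆ = ℕₚ.≤-trans (n≤n^ n 1≤q⋆) ν≥

    all≤W : 1 ℕ.≤ q⋆ → ∣ ⌜ allFin n ⌝ˡ ∣ ℕ.≤ W
    all≤W 1≤q⋆ = ℕₚ.≤-trans (∣⌜⌝ˡ∣-bound 𝕂 (allFin n)) (ℕₚ.≤-trans (ℕ.s≤s (ℕₚ.*-mono-≤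
      (ℕₚ.≤-trans (ℕₚ.≤-reflexive (length-tabulate {n = n} (λ i → i))) (n≤ν 1≤q⋆))
      (ℕₚ.+-monoʳ-≤ 2 (ℕₚ.*-monoʳ-≤ 4 (n≤ν 1≤q⋆))))) W≥)

    -- The suffixes of the sum below `B`, from which its summands are peeled off.
    r₁ r₂ r₃ r₄ r₅ r₆ : ℕ
    r₆ = (1 ℕ.+ Q ℕ.* 2) ℕ.+ (1 ℕ.+ 4 ℕ.* ν)
    r₅ = (1 ℕ.+ size ε) ℕ.+ r₆
    r₄ = Pe ℕ.+ r₅
    r₃ = Dmax ℕ.+ r₄
    r₂ = W ℕ.+ r₃
    r₁ = N ℕ.+ r₂

    r₁≤B : r₁ ℕ.≤ B
    r₁≤B = ℕₚ.m+n≤o⇒n≤o 3 B≥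
    r₂≤B : r₂ ℕ.≤ B
    r₂≤B = ℕₚ.m+n≤o⇒n≤o N r₁≤B
    r₃≤B : r₃ ℕ.≤ B
    r₃≤B = ℕₚ.m+n≤o⇒n≤o W r₂≤B
    r₄≤B : r₄ ℕ.≤ B
    r₄≤B = ℕₚ.m+n≤o⇒n≤o Dmax r₃≤B
    r₅≤B : r₅ ℕ.≤ B
    r₅≤B = ℕₚ.m+n≤o⇒n≤o Pe r₄≤B
    r₆≤B : r₆ ℕ.≤ B
    r₆≤B = ℕₚ.m+n≤o⇒n≤o (1 ℕ.+ size ε) r₅≤B

    open Correctness ℰ natural {n} {q} {N} {W} {Pm} {Pe} {Dmax} {B}
      (ℕₚ.m+n≤o⇒m≤o 3 B≥) (ℕₚ.m+n≤o⇒m≤o N r₁≤B) (ℕₚ.m+n≤o⇒m≤o W r₂≤B)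
      (ℕₚ.m+n≤o⇒m≤o Dmax r₃≤B) (ℕₚ.m+n≤o⇒m≤o Pe r₄≤B) minimizer error

    treeSize≤ : treeSize q⋆ ℕ.+ suc N ℕ.≤ Dmax
    treeSize≤ = ℕₚ.≤-trans (ℕₚ.+-monoˡ-≤ (suc N) (ℕₚ.≤-trans (ℕₚ.m≤m+n (treeSize q⋆) V)
      (ℕₚ.≤-trans (treeSize-bound q⋆) (ℕₚ.*-monoˡ-≤ (2 ℕ.* V) 2^q⋆≤Q)))) Dmax≥

    open Loop {q⋆} {ν} {Q} R ε R≤q R≤N (ℕₚ.m+n≤o⇒m≤o (1 ℕ.+ size ε) r₅≤B)
      (ℕₚ.≤-trans (ℕ.s≤s (ℕₚ.*-monoˡ-≤ 2 (ℕₚ.<⇒≤ q⋆<Q))) (ℕₚ.m+n≤o⇒m≤o (1 ℕ.+ Q ℕ.* 2) r₆≤B))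
      treeSize≤ (proj₁ optimum) n≤ν all≤W
      (λ 1≤q⋆ i i≤n →
        ℕₚ.≤-trans (∣⌜⌝ℕ∣-bound 𝕂 (ℕₚ.≤-trans i≤n (n≤ν 1≤q⋆))) (ℕₚ.m+n≤o⇒n≤o (1 ℕ.+ Q ℕ.* 2) r₆≤B))
      base^q⋆≤Q q⋆<Q

module Polynomial (𝕂 : Scalars) (A-err A-min : Theory.Algorithm 𝕂) (pe : Poly 3) (pm : Poly 2) where
  open Theory 𝕂

  -- The order avoids circularity: leaves carry minimizer outputs, so `P̂m` enters the tree size
  -- `D̂`. The error oracle reads such trees, so `D̂` enters `P̂e`, and `B̂` comes last.
  N̂ t̂ ν̂ ê Q̂ Ŵ P̂m V̂ D̂ P̂e B̂ bound : Poly 4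
  N̂  = var 0F
  t̂  = var 1F
  ν̂  = var 2F
  ê  = var 3F
  Q̂  = con 6 ⊗ ((ν̂ ⊗ ν̂) ⊗ (ν̂ ⊗ ν̂))
  Ŵ  = con 1 ⊕ (ν̂ ⊗ (con 2 ⊕ (con 4 ⊗ ν̂)))
  P̂m = pm [ t̂ ∷ N̂ ∷ [] ]ᵖ
  V̂  = (con 8 ⊕ Ŵ) ⊕ P̂m
  D̂  = (Q̂ ⊗ (con 2 ⊗ V̂)) ⊕ (con 1 ⊕ N̂)
  P̂e = pe [ t̂ ∷ N̂ ∷ D̂ ∷ [] ]ᵖ
  B̂  = con 3 ⊕
      (N̂ ⊕ (Ŵ ⊕ (D̂ ⊕ (P̂e ⊕ ((con 1 ⊕ ê) ⊕ ((con 1 ⊕ (Q̂ ⊗ con 2)) ⊕ (con 1 ⊕ (con 4 ⊗ ν̂))))))))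

  σ : Vec (Poly 4) 5
  σ = B̂ ∷ P̂e ∷ P̂m ∷ Q̂ ∷ ν̂ ∷ []

  bound = Search.costPoly 𝕂 A-err A-min [ σ ]ᵖ

theorem3 :
    (𝕂 : Scalars) →
    let open Scalars 𝕂
        open Theory 𝕂
    in
    (ℰ : ErrorMetric) (t : ℕ → ℕ) → Natural ℰ → Efficient t ℰ →
    Σ Algorithm λ 𝒜 → Σ (Poly 4) λ p →
    ∀ {n q q⋆ : ℕ} (R : RDT n) (ε : Carrier) →
    queries R ℕ.≤ q → 0# < ε → ε < 1# →
    q⋆ IsOptimalFor ℰ , R , ε →
    ∃[ D ] (𝒜 on (⌜ R ⌝ ∙ scalar ε) returns ⌜ tree D ⌝
              within ⟦ p ⟧ (descriptionLength R ∷ t q ∷ n ^ q⋆ ∷ size ε ∷ []))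
         × queries (tree D) ℕ.≤ q⋆
         × value (ℰ R D) ≤ ε
theorem3 𝕂 ℰ t natural efficient = instanceOpt , bound , λ {n} {q} {q⋆} R ε R≤q _ _ optimum →
  let as = descriptionLength R ∷ t q ∷ n ^ q⋆ ∷ size ε ∷ [] in
  Bound.within-budget 𝕂 A-err A-min ℰ natural
    {N = descriptionLength R} {⟦ Ŵ ⟧ as} {⟦ P̂m ⟧ as} {⟦ P̂e ⟧ as} {⟦ D̂ ⟧ as}
    {⟦ B̂ ⟧ as} {⟦ Q̂ ⟧ as} {n ^ q⋆} {⟦ bound ⟧ as}
    R ε R≤q ℕₚ.≤-refl optimum ℕₚ.≤-refl ℕₚ.≤-refl ℕₚ.≤-refl ℕₚ.≤-refl ℕₚ.≤-refl
    -- The restrictions R′ satisfy the query bound for the same `q`, so `t` is evaluated at `q`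
    -- only.
    (λ R′ R′≤q R′≤N → let c , c-min , k , k⇓ , k≤ = min-spec R′ R′≤q in
      c , c-min , k , k⇓ , ℕₚ.≤-trans k≤
          (⟦⟧-mono-subst pm (t̂ ∷ N̂ ∷ []) as (t q ∷ descriptionLength R′ ∷ [])
        (ℕₚ.≤-refl ∷ R′≤N ∷ [])))
    (λ R′ D R′≤q R′≤N D≤ → let k , k⇓ , k≤ = err-spec R′ D R′≤q in
      k , k⇓ , ℕₚ.≤-trans k≤
          (⟦⟧-mono-subst pe (t̂ ∷ N̂ ∷ D̂ ∷ []) as
            (t q ∷ descriptionLength R′ ∷ descriptionLength (tree D) ∷ [])
        (ℕₚ.≤-refl ∷ R′≤N ∷ D≤ ∷ [])))
    (⟦⟧-mono-subst costPoly σ as (⟦ B̂ ⟧ as ∷ ⟦ P̂e ⟧ as ∷ ⟦ P̂m ⟧ as ∷ ⟦ Q̂ ⟧ as ∷ n ^ q⋆ ∷ [])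
      (ℕₚ.≤-refl ∷ ℕₚ.≤-refl ∷ ℕₚ.≤-refl ∷ ℕₚ.≤-refl ∷ ℕₚ.≤-refl ∷ []))
  where
  open Scalars 𝕂
  open Theory 𝕂
  A-err = proj₁ (Theory.Efficient.error efficient)
  A-min = proj₁ (Theory.Efficient.minimizer efficient)
  pe = proj₁ (proj₂ (Theory.Efficient.error efficient))
  pm = proj₁ (proj₂ (Theory.Efficient.minimizer efficient))
  err-spec = proj₂ (proj₂ (Theory.Efficient.error efficient))
  min-spec = proj₂ (proj₂ (Theory.Efficient.minimizer efficient))
  open Search 𝕂 A-err A-min
  open Polynomial 𝕂 A-err A-min pe pm
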